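{- For every $n\ge1$, $\widehat{\mathrm{P}}^{\mathrm{VAL}_n}=\widehat{\mathrm{P}}^{\mathrm{SAT}_n}$.
   Context: $\Sigma=\{0,1\}$, $\Sigma^*$ the finite nonempty binary strings; for $x\in\Sigma^m$, $\pi_1(x)=x_1$. $\mathbb{P}_+\Sigma=\{\{0\},\{1\},\Sigma\}$. A promise problem is $\phi:\Sigma^*\to\mathbb{P}_+\Sigma$; a problem $\psi:\Sigma^*\to\Sigma$ is identified with $x\mapsto\{\psi(x)\}$. A $\phi$-oracle Turing machine may, given $x$, obtain in unit time some $y\in\phi(x)$; when $\phi(x)=\Sigma$ the returned value is nondeterministic (adversarial), independently on each call. $\phi_1\propto_T\phi_2$ means there is a $\phi_2$-oracle Turing machine $M$ and a polynomial $p$ such that on every input $x$ every possible computation path halts within $p(|x|)$ steps and outputs an element of $\phi_1(x)$. $\widehat{\mathrm{P}}^{\phi}=\{\phi_1:\phi_1\propto_T\phi\}$. Level-$n$ problems: the input encodes (e.g. as a Boolean formula) $f:\Sigma^{m_1}\times\dots\times\Sigma^{m_n}\to\Sigma$, written $f(x,\dots)$ with $x\in\Sigma^{m_1}$; $f_x$ is $f$ with $x$ fixed. For a constant $c$, $\mathrm{SAT}_0(c)=\overline{\mathrm{SAT}}_0(c)=c$; for $n\ge1$, $\mathrm{SAT}_n(f)=1\iff\exists x:\overline{\mathrm{SAT}}_{n-1}(f_x)=1$, $\overline{\mathrm{SAT}}_n(f)=1\iff\forall x,\ \mathrm{SAT}_{n-1}(f_x)=1$, and $\mathrm{VAL}_n(f)=\{\pi_1x:\overline{\mathrm{SAT}}_{n-1}(f_x)=1\}$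 if $\mathrm{SAT}_n(f)=1$, else $\Sigma$. -}

module Defs where

open import Data.Bool.Base using (Bool; true; false; not; _∧_; _∨_; T)
open import Data.Bool.Properties using (T?) renaming (_≟_ to _≟ᵇ_)
open import Data.Empty using (⊥-elim)
open import Data.Fin.Base using (Fin; zero; suc; toℕ)
open import Data.Fin.Properties using () renaming (_≟_ to _≟ᶠ_)
open import Data.Fin.Subset.Properties using (anySubset?)
open import Data.List.Base as List using (List; []; _∷_; _++_; replicate; foldr)
open import Data.List.Properties using (++-assoc; ++-identityʳ)
open import Data.List.NonEmpty as List⁺ using (List⁺; toList) renaming (_∷_ to _∷⁺_)
open import Data.Maybe.Base using (Maybe; just; nothing; fromMaybe)
open import Data.Nat.Base using (ℕ; zero; suc; _+_; _*_; _⊔_; NonZero)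
open import Data.Nat.Properties using (+-identityʳ; +-suc)
open import Data.Product.Base using (Σ; ∃; _×_; _,_)
open import Data.Unit.Base using (⊤)
open import Data.Vec.Base as Vec using (Vec; []; _∷_)
import Data.Vec.Functional as Vector
open import Function.Base using (_∘_; id)
open import Function.Bundles using (_↔_)
open import Level using (0ℓ) renaming (suc to lsuc)
open import Relation.Binary.PropositionalEquality
  using (_≡_; refl; sym; trans; cong)
open import Relation.Nullary using (Dec; yes; no; does; ¬_)
open import Relation.Nullary.Decidable using (map′; decidable-stable; _×-dec_; ¬?)
open import Relation.Unary using (Pred; Decidable)

Str : Set
Str = List⁺ Bool

-- The nonempty subsets of {0,1}.
data P₊ : Set where
  only   : Bool → P₊
  either : P₊

infix 4 _∈_
_∈_ : Bool → P₊ → Set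
y ∈ only b = y ≡ b
y ∈ either = ⊤

Problem PromiseProblem : Set
Problem        = Str → Bool
PromiseProblem = Str → P₊

asPromise : Problem → PromiseProblem
asPromise ψ x = only (ψ x)

subset : {P : Bool → Set} → Decidable P → ∃ P → P₊
subset P? ne with P? false | P? true
... | yes _ | yes _ = either
... | yes _ | no  _ = only false
... | no  _ | yes _ = only true
subset P? (false , p) | no ¬p | no _  = ⊥-elim (¬p p)
subset P? (true  , p) | no _  | no ¬p = ⊥-elim (¬p p)

data Sym (g : ℕ) : Set where
  blank : Sym g
  bit   : Bool → Sym g
  aux   : Fin g → Sym g

data Dir : Set where
  left stay right : Dir

-- A two-way infinite tape.  Both lists start next to the head; the cells
-- beyond their ends are blank.
record Tape (g : ℕ) : Set where
  constructor tape
  field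
    before : List (Sym g)
    head   : Sym g
    after  : List (Sym g)

module _ {g : ℕ} where

  write : Sym g → Tape g → Tape g
  write s (tape ls _ rs) = tape ls s rs

  shift : Dir → Tape g → Tape g
  shift stay  t                   = t
  shift left  (tape []       s rs) = tape [] blank (s ∷ rs)
  shift left  (tape (l ∷ ls) s rs) = tape ls l (s ∷ rs)
  shift right (tape ls s [])       = tape (s ∷ ls) blank []
  shift right (tape ls s (r ∷ rs)) = tape (s ∷ ls) r rs

  blankTape : Tape g
  blankTape = tape [] blank []

  inputTape : Str → Tape g
  inputTape (b ∷⁺ bs) = tape [] (bit b) (List.map bit bs)

  leadingBits : List (Sym g) → List Bool
  leadingBits (bit b ∷ ss) = b ∷ leadingBits ss
  leadingBits _            = []

  -- The string on a tape runs from the head rightwards to the first cell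
  -- not holding a bit.
  contents : Tape g → List Bool
  contents (tape _ s rs) = leadingBits (s ∷ rs)

data Action (State : Set) (g k : ℕ) : Set where
  halt : Bool → Action State g k
  move : State → Vec (Sym g × Dir) k → Action State g k
  ask  : (Bool → State) → Action State g k

-- Tape 0 holds the input, tape 1 is the oracle tape; all tapes but tape 0
-- are initially blank.  The alphabet has `extra` symbols besides bits and
-- blank.
record OracleTM : Set₁ where
  field
    State  : Set
    finite : ∃ λ q → State ↔ Fin q
    extra  : ℕ
    work   : ℕ
    start  : State

  tapes : ℕ
  tapes = 2 + work

  field
    δ : State → Vec (Sym extra) tapes → Action State extra tapes

  Config : Set
  Config = State × Vec (Tape extra) tapes

  initial : Str → Config
  initial x = start , inputTape x ∷ Vec.replicate (1 + work) blankTape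

  action : Config → Action State extra tapes
  action (q , ts) = δ q (Vec.map Tape.head ts)

  query : Config → List Bool
  query (_ , _ ∷ t ∷ _) = contents t

  moveTo : State → Vec (Sym extra × Dir) tapes → Config → Config
  moveTo q ws (_ , ts) =
    q , Vec.zipWith (λ { (s , d) t → shift d (write s t) }) ws ts

  jumpTo : State → Config → Config
  jumpTo q (_ , ts) = q , ts

-- The empty string is not an instance, so asking about it yields no
-- information: either bit may come back.
Answer : PromiseProblem → List Bool → Bool → Set
Answer φ []       y = ⊤
Answer φ (b ∷ bs) y = y ∈ φ (b ∷⁺ bs)

module _ (M : OracleTM) (φ : PromiseProblem) where
  open OracleTM M

  -- AllPaths S t c: every computation path of M from c with oracle φ halts
  -- after at most t steps and outputs an element of S.
  data AllPaths (S : P₊) : ℕ → Config → Set where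
    halts : ∀ {t c y} → action c ≡ halt y → y ∈ S → AllPaths S t c
    moves : ∀ {t c q ws} → action c ≡ move q ws →
            AllPaths S t (moveTo q ws c) → AllPaths S (suc t) c
    asks  : ∀ {t c r} → action c ≡ ask r →
            (∀ y → Answer φ (query c) y → AllPaths S t (jumpTo (r y) c)) →
            AllPaths S (suc t) c

-- Polynomials are coefficient lists, constant term first.
evalPoly : List ℕ → ℕ → ℕ
evalPoly p n = foldr (λ a v → a + n * v) 0 p

infix 4 _∝ᵀ_
_∝ᵀ_ : PromiseProblem → PromiseProblem → Set₁
φ₁ ∝ᵀ φ₂ = Σ OracleTM λ M → ∃ λ p → ∀ x →
  AllPaths M φ₂ (φ₁ x) (evalPoly p (List⁺.length x)) (OracleTM.initial M x)

P̂ : PromiseProblem → Pred PromiseProblem (lsuc 0ℓ)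
P̂ φ φ₁ = φ₁ ∝ᵀ φ

-- An entry k stands for a block of length m = 1 + k, since strings are
-- nonempty.
Fun : ∀ {n} → Vec ℕ n → Set
Fun []       = Bool
Fun (k ∷ ks) = Vec Bool (suc k) → Fun ks

mutual
  Sat : ∀ {n} (ks : Vec ℕ n) → Fun ks → Set
  Sat []       c = T c
  Sat (k ∷ ks) f = ∃ λ x → CoSat ks (f x)

  CoSat : ∀ {n} (ks : Vec ℕ n) → Fun ks → Set
  CoSat []       c = T c
  CoSat (k ∷ ks) f = ∀ x → Sat ks (f x)

-- `Subset m` of the library is Vec Bool m.
anyVec? : ∀ {m} {P : Vec Bool m → Set} → Decidable P → Dec (∃ P)
anyVec? = anySubset?

allVec? : ∀ {m} {P : Vec Bool m → Set} → Decidable P → Dec (∀ x → P x)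
allVec? P? = map′ (λ ¬∃¬ x → decidable-stable (P? x) λ ¬p → ¬∃¬ (x , ¬p))
                  (λ { ∀p (x , ¬p) → ¬p (∀p x) })
                  (¬? (anyVec? (¬? ∘ P?)))

mutual
  sat? : ∀ {n} (ks : Vec ℕ n) (f : Fun ks) → Dec (Sat ks f)
  sat? []       c = T? c
  sat? (k ∷ ks) f = anyVec? (λ x → coSat? ks (f x))

  coSat? : ∀ {n} (ks : Vec ℕ n) (f : Fun ks) → Dec (CoSat ks f)
  coSat? []       c = T? c
  coSat? (k ∷ ks) f = allVec? (λ x → sat? ks (f x))

FirstBit : ∀ {n} k (ks : Vec ℕ n) → Fun (k ∷ ks) → Bool → Set
FirstBit k ks f y = ∃ λ x → Vec.head x ≡ y × CoSat ks (f x)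

firstBit? : ∀ {n} k (ks : Vec ℕ n) f → Decidable (FirstBit k ks f)
firstBit? k ks f y = anyVec? λ x → (Vec.head x ≟ᵇ y) ×-dec coSat? ks (f x)

val : ∀ {n} (ks : Vec ℕ (suc n)) → Fun ks → P₊
val (k ∷ ks) f with sat? (k ∷ ks) f
... | yes (x , p) = subset (firstBit? k ks f) (Vec.head x , x , refl , p)
... | no  _       = either

-- var i j is the j-th variable (counting from 0) of the i-th block.
data Formula (n : ℕ) : Set where
  const   : Bool → Formula n
  var     : Fin n → ℕ → Formula n
  neg     : Formula n → Formula n
  and or  : Formula n → Formula n → Formula n

eval : ∀ {n} → Formula n → (Fin n → ℕ → Bool) → Bool
eval (const b) ρ = b
eval (var i j) ρ = ρ i j
eval (neg φ)   ρ = not (eval φ ρ)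
eval (and φ ψ) ρ = eval φ ρ ∧ eval ψ ρ
eval (or φ ψ)  ρ = eval φ ρ ∨ eval ψ ρ

-- The largest index of a variable of block i, or 0 if there is none.
maxIndex : ∀ {n} → Formula n → Fin n → ℕ
maxIndex (const b) i = 0
maxIndex (var i′ j) i with i ≟ᶠ i′
... | yes _ = j
... | no  _ = 0
maxIndex (neg φ)   i = maxIndex φ i
maxIndex (and φ ψ) i = maxIndex φ i ⊔ maxIndex ψ i
maxIndex (or φ ψ)  i = maxIndex φ i ⊔ maxIndex ψ i

-- Block i of the function encoded by φ has length 1 + maxIndex φ i, the
-- least positive length that accommodates the variables of φ.
blocks : ∀ {n} → Formula n → Vec ℕ n
blocks φ = Vec.tabulate (maxIndex φ)

-- The value past the end is immaterial: by the choice of `blocks` it is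
-- never looked up.
lookup₀ : ∀ {m} → Vec Bool m → ℕ → Bool
lookup₀ []       _       = false
lookup₀ (b ∷ bs) zero    = b
lookup₀ (b ∷ bs) (suc j) = lookup₀ bs j

curry : ∀ {n} (ks : Vec ℕ n) → ((Fin n → ℕ → Bool) → Bool) → Fun ks
curry []       g = g λ ()
curry (k ∷ ks) g = λ x → curry ks λ ρ → g (lookup₀ x Vector.∷ ρ)

⟦_⟧ : ∀ {n} (φ : Formula n) → Fun (blocks φ)
⟦ φ ⟧ = curry (blocks φ) (eval φ)

-- Formulas are written in postfix notation, with variable and block
-- indices in unary (so that block lengths are bounded by the length of
-- the input).
unary : ℕ → List Bool
unary j = replicate j true ++ false ∷ []

encode : ∀ {n} → Formula n → List Bool
encode (const b) = false ∷ false ∷ b ∷ []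
encode (var i j) = true ∷ true ∷ unary (toℕ i) ++ unary j
encode (neg φ)   = encode φ ++ true ∷ false ∷ []
encode (and φ ψ) = encode φ ++ encode ψ ++ false ∷ true ∷ false ∷ []
encode (or φ ψ)  = encode φ ++ encode ψ ++ false ∷ true ∷ true ∷ []

module _ {n : ℕ} where
  mutual
    -- decode st w reads w on top of the stack st of formulas read so far.
    decode : List (Formula n) → List Bool → Maybe (Formula n)
    decode st           (false ∷ false ∷ b ∷ w)    = decode (const b ∷ st) w
    decode (ψ ∷ φ ∷ st) (false ∷ true ∷ false ∷ w) = decode (and φ ψ ∷ st) w
    decode (ψ ∷ φ ∷ st) (false ∷ true ∷ true ∷ w)  = decode (or φ ψ ∷ st) w
    decode st           (true ∷ true ∷ w)          = decodeBlock st n id w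
    decode (φ ∷ st)     (true ∷ false ∷ w)         = decode (neg φ ∷ st) w
    decode (φ ∷ [])     []                         = just φ
    decode _            _                          = nothing

    decodeBlock : List (Formula n) → ∀ k → (Fin k → Fin n) →
                  List Bool → Maybe (Formula n)
    decodeBlock st (suc k) ι (false ∷ w) = decodeIndex st (ι zero) 0 w
    decodeBlock st (suc k) ι (true ∷ w)  = decodeBlock st k (ι ∘ suc) w
    decodeBlock _  _       _ _           = nothing

    decodeIndex : List (Formula n) → Fin n → ℕ →
                  List Bool → Maybe (Formula n)
    decodeIndex st i j (false ∷ w) = decode (var i j ∷ st) w
    decodeIndex st i j (true ∷ w)  = decodeIndex st i (suc j) w
    decodeIndex _  _ _ []          = nothing

-- Every formula has a code, and `decode` succeeds only on codes.
module _ {n : ℕ} where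
  decodeIndex-unary : ∀ st (i : Fin n) a j w →
    decodeIndex st i a (unary j ++ w) ≡ decode (var i (a + j) ∷ st) w
  decodeIndex-unary st i a zero    w =
    cong (λ j → decode (var i j ∷ st) w) (sym (+-identityʳ a))
  decodeIndex-unary st i a (suc j) w =
    trans (decodeIndex-unary st i (suc a) j w)
          (cong (λ j → decode (var i j ∷ st) w) (sym (+-suc a j)))

  decodeBlock-unary : ∀ st k (ι : Fin k → Fin n) i w →
    decodeBlock st k ι (unary (toℕ i) ++ w) ≡ decodeIndex st (ι i) 0 w
  decodeBlock-unary st (suc k) ι zero    w = refl
  decodeBlock-unary st (suc k) ι (suc i) w = decodeBlock-unary st k (ι ∘ suc) i w

  decode-++ : ∀ st (φ : Formula n) w →
              decode st (encode φ ++ w) ≡ decode (φ ∷ st) w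
  decode-++ st (const b) w = refl
  decode-++ st (var i j) w
    rewrite ++-assoc (unary (toℕ i)) (unary j) w =
    trans (decodeBlock-unary st n id i _) (decodeIndex-unary st i 0 j w)
  decode-++ st (neg φ) w
    rewrite ++-assoc (encode φ) (true ∷ false ∷ []) w = decode-++ st φ _
  decode-++ st (and φ ψ) w
    rewrite ++-assoc (encode φ) (encode ψ ++ false ∷ true ∷ false ∷ []) w
          | ++-assoc (encode ψ) (false ∷ true ∷ false ∷ []) w =
    trans (decode-++ st φ _) (decode-++ (φ ∷ st) ψ _)
  decode-++ st (or φ ψ) w
    rewrite ++-assoc (encode φ) (encode ψ ++ false ∷ true ∷ true ∷ []) w
          | ++-assoc (encode ψ) (false ∷ true ∷ true ∷ []) w =
    trans (decode-++ st φ _) (decode-++ (φ ∷ st) ψ _)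

  decode-encode : (φ : Formula n) → decode [] (encode φ) ≡ just φ
  decode-encode φ =
    trans (cong (decode []) (sym (++-identityʳ (encode φ)))) (decode-++ [] φ [])

  encodeStack : List (Formula n) → List Bool
  encodeStack []       = []
  encodeStack (φ ∷ st) = encodeStack st ++ encode φ

  mutual
    decode-sound : ∀ st w {φ : Formula n} → decode st w ≡ just φ →
                   encodeStack st ++ w ≡ encode φ
    decode-sound st (false ∷ false ∷ b ∷ w) eq =
      trans (sym (++-assoc (encodeStack st) _ w))
            (decode-sound (const b ∷ st) w eq)
    decode-sound (ψ ∷ φ ∷ st) (false ∷ true ∷ false ∷ w) eq =
      trans (binary st φ ψ _ w) (decode-sound (and φ ψ ∷ st) w eq)
    decode-sound (ψ ∷ φ ∷ st) (false ∷ true ∷ true ∷ w) eq =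
      trans (binary st φ ψ _ w) (decode-sound (or φ ψ ∷ st) w eq)
    decode-sound (φ ∷ st) (true ∷ false ∷ w) eq =
      trans (regroup (encodeStack st) (encode φ) _ w)
            (decode-sound (neg φ ∷ st) w eq)
    decode-sound st (true ∷ true ∷ w) eq =
      decodeBlock-sound st n id 0 (λ _ → refl) w eq
    decode-sound (φ ∷ []) [] refl = ++-identityʳ (encode φ)

    decodeBlock-sound : ∀ st k (ι : Fin k → Fin n) a →
      (∀ i → toℕ (ι i) ≡ a + toℕ i) → ∀ w {φ} →
      decodeBlock st k ι w ≡ just φ →
      encodeStack st ++ true ∷ true ∷ replicate a true ++ w ≡ encode φ
    decodeBlock-sound st (suc k) ι a ι≡ (false ∷ w) eq =
      trans (cong (λ v → encodeStack st ++ true ∷ true ∷ v)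
                  (trans (sym (++-assoc (replicate a true) (false ∷ []) w))
                         (cong (λ j → unary j ++ w)
                               (sym (trans (ι≡ zero) (+-identityʳ a))))))
            (decodeIndex-sound st (ι zero) 0 w eq)
    decodeBlock-sound st (suc k) ι a ι≡ (true ∷ w) eq =
      trans (cong (λ v → encodeStack st ++ true ∷ true ∷ v) (replicate-snoc a w))
            (decodeBlock-sound st k (ι ∘ suc) (suc a)
              (λ i → trans (ι≡ (suc i)) (+-suc a (toℕ i))) w eq)

    decodeIndex-sound : ∀ st (i : Fin n) a w {φ} →
      decodeIndex st i a w ≡ just φ →
      encodeStack st ++ true ∷ true ∷ unary (toℕ i) ++ replicate a true ++ w
        ≡ encode φ
    decodeIndex-sound st i a (false ∷ w) eq =
      trans (cong (λ v → encodeStack st ++ true ∷ true ∷ v)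
                  (sym (regroup′ (unary (toℕ i)) (replicate a true) _ w)))
            (trans (sym (++-assoc (encodeStack st) (encode (var i a)) w))
                   (decode-sound (var i a ∷ st) w eq))
    decodeIndex-sound st i a (true ∷ w) eq =
      trans (cong (λ v → encodeStack st ++ true ∷ true ∷ unary (toℕ i) ++ v)
                  (replicate-snoc a w))
            (decodeIndex-sound st i (suc a) w eq)

    replicate-snoc : ∀ a (w : List Bool) →
      replicate a true ++ true ∷ w ≡ replicate (suc a) true ++ w
    replicate-snoc zero    w = refl
    replicate-snoc (suc a) w = cong (true ∷_) (replicate-snoc a w)

    regroup′ : ∀ (u v x w : List Bool) → (u ++ v ++ x) ++ w ≡ u ++ v ++ x ++ w
    regroup′ u v x w =
      trans (++-assoc u (v ++ x) w) (cong (u ++_) (++-assoc v x w))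

    regroup : ∀ (u v x w : List Bool) → (u ++ v) ++ x ++ w ≡ (u ++ v ++ x) ++ w
    regroup u v x w =
      trans (++-assoc u v (x ++ w)) (sym (regroup′ u v x w))

    binary : ∀ st (φ ψ : Formula n) x w →
      ((encodeStack st ++ encode φ) ++ encode ψ) ++ x ++ w ≡
      (encodeStack st ++ encode φ ++ encode ψ ++ x) ++ w
    binary st φ ψ x w =
      trans (regroup (encodeStack st ++ encode φ) (encode ψ) x w)
            (cong (_++ w) (++-assoc (encodeStack st) (encode φ) (encode ψ ++ x)))

-- A string that is not the code of a formula is read as the constant 0.
formula : ∀ n → Str → Formula n
formula n x = fromMaybe (const false) (decode [] (toList x))

SAT : ℕ → Problem
SAT n x = let φ = formula n x in does (sat? (blocks φ) ⟦ φ ⟧)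

VAL : (n : ℕ) .{{_ : NonZero n}} → PromiseProblem
VAL n@(suc _) x = let φ = formula n x in val (blocks φ) ⟦ φ ⟧

{-# OPTIONS --safe #-}

-- VAL reduces to SAT with one query: the truth value of f(x, …) ∧ π₁ x is an
-- element of VAL f.  Conversely, asking VAL about f with the bits found so far
-- fixed yields, bit by bit, an x with coSAT(f_x) = 1 provided that SAT f = 1.
-- Whether coSAT(f_x) = 1 is decided by one more VAL query: the existential
-- player picks a bit b, claiming with b = 1 that it is so and with b = 0 that
-- it is not.  The quantifiers of the negation start one block earlier, so that
-- both claims fit in n blocks; as exactly one of them is true, VAL returns b.
-- That a string is the code of some f has to be checked beforehand, since the
-- others stand for the constant 0, about which VAL gives no information.
--
-- Oracle machines are composed by inlining: the outer machine runs with its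
-- oracle tape replaced by a work tape, and each of its queries is answered by
-- a program that restores this tape and blanks its own ones.
module Submission where

open import Defs
open import Data.Bool.Base using (Bool; true; false; not; _∧_; _∨_; T; if_then_else_)
open import Data.Bool.Properties using (∨-identityʳ; ∧-identityʳ)
open import Data.Empty using (⊥-elim)
open import Data.Fin.Base using (Fin; zero; suc; toℕ; inject₁)
open import Data.Fin.Properties using (+↔⊎; *↔×; 1↔⊤; 2↔Bool; toℕ-inject₁)
  renaming (_≟_ to _≟ᶠ_)
open import Data.List.Base using (List; []; _∷_; _++_; _ʳ++_; map; length; replicate; foldr)
open import Data.List.NonEmpty as List⁺ using () renaming (_∷_ to _∷⁺_)
open import Data.List.Properties
  using (++-identityʳ; ++-assoc; ++-ʳ++; ʳ++-ʳ++; ʳ++-defn; map-ʳ++; length-ʳ++;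
         length-++; length-replicate; foldr-++)
open import Data.Maybe.Base using (Maybe; just; nothing; maybe; is-just; fromMaybe)
open import Data.Nat.Base
  using (ℕ; zero; suc; _+_; _*_; _∸_; _⊔_; _≤_; _<_; z≤n; s≤s; s≤s⁻¹; NonZero)
open import Data.Nat.Properties
open import Data.Nat.Solver using (module +-*-Solver)
open import Data.Product.Base using (∃; _×_; _,_; proj₁; proj₂)
open import Data.Product.Function.NonDependent.Propositional using (_×-↔_)
open import Data.Sum.Base using (_⊎_; inj₁; inj₂)
open import Data.Sum.Function.Propositional using (_⊎-↔_)
open import Data.Unit.Base using (⊤; tt)
open import Data.Vec.Base as Vec using (Vec; []; _∷_)
import Data.Vec.Functional as Vector
open import Data.Vec.Properties
  using (map-++; zipWith-++; lookup-map; lookup∘tabulate; lookup∘updateAt; updateAt-updateAt)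
open import Data.Vec.Relation.Binary.Pointwise.Inductive using (Pointwise; []; _∷_)
open import Function.Base using (_∘_; id)
open import Function.Bundles using (_↔_)
open import Function.Construct.Composition using (_↔-∘_)
open import Function.Construct.Identity using (↔-id)
open import Function.Construct.Symmetry using (↔-sym)
open import Relation.Binary.PropositionalEquality
  using (_≡_; refl; sym; trans; cong; cong₂; subst)
open import Relation.Nullary using (¬_; yes; no)
open import Relation.Nullary.Decidable using (decidable-stable)
open import Relation.Unary using (Decidable; _⊆_; _≐_)
open +-*-Solver using (solve; con; _:+_; _:*_; _:=_)

-- The adversarial oracle gives no sign whether a query was about a satisfiable f, so the collected
-- bits prove nothing by themselves. What survives each round is an implication: if f is
-- satisfiable, then so is f with these bits fixed. This is enough because the final query is
-- satisfiable in any case, which makes its answer binding. The length of the first block is never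
-- computed. As indices are written in unary, a code has more bits than the value of any index in
-- it, and the search makes as many rounds as there are bits; bits past the block fix variables that
-- do not occur. Fixing bits and moving blocks change the block lengths, on which `Sat` depends. The
-- argument about formulas therefore lives in games with infinite blocks, where a substitution is a
-- mere change of assignment. Only the case distinction between won and lost games goes back to
-- finite blocks, where it is decidable.

-- The cells left of the head, nearest first, and those from the head on.
HalfTapes : ℕ → Set
HalfTapes g = List (Sym g) × List (Sym g)

-- Tapes up to trailing blanks

module _ {g : ℕ} where

  hd : List (Sym g) → Sym g
  hd []      = blank
  hd (s ∷ _) = s

  tl : List (Sym g) → List (Sym g)
  tl []       = []
  tl (_ ∷ ss) = ss

  -- Not creating trailing blanks makes moving away and back the identity.
  infixr 5 _∷ᵇ_
  _∷ᵇ_ : Sym g → List (Sym g) → List (Sym g)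
  blank ∷ᵇ [] = []
  s     ∷ᵇ ss = s ∷ ss

  hd-∷ᵇ : ∀ s ss → hd (s ∷ᵇ ss) ≡ s
  hd-∷ᵇ blank   []       = refl
  hd-∷ᵇ blank   (_ ∷ _) = refl
  hd-∷ᵇ (bit _) _        = refl
  hd-∷ᵇ (aux _) _        = refl

  tl-∷ᵇ : ∀ s ss → tl (s ∷ᵇ ss) ≡ ss
  tl-∷ᵇ blank   []       = refl
  tl-∷ᵇ blank   (_ ∷ _) = refl
  tl-∷ᵇ (bit _) _        = refl
  tl-∷ᵇ (aux _) _        = refl

  cell : List (Sym g) → ℕ → Sym g
  cell ss zero    = hd ss
  cell ss (suc i) = cell (tl ss) i

  infix 4 _≋_ _≈_
  -- `shift` leaves explicit blanks behind where `go` leaves none, so half tapes are compared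
  -- position by position, also past their ends.
  _≋_ : List (Sym g) → List (Sym g) → Set
  ss ≋ ss′ = ∀ i → cell ss i ≡ cell ss′ i

  ∷-≋ : ∀ {s s′ ss ss′} → s ≡ s′ → ss ≋ ss′ → s ∷ ss ≋ s′ ∷ᵇ ss′
  ∷-≋ {s′ = s′} {ss′ = ss′} e es zero = trans e (sym (hd-∷ᵇ s′ ss′))
  ∷-≋ {s′ = s′} {ss′ = ss′} e es (suc i) =
    trans (es i) (cong (λ ss → cell ss i) (sym (tl-∷ᵇ s′ ss′)))

  uncons-≋ : ∀ {ss ss′ : List (Sym g)} → ss ≋ ss′ → hd ss ∷ tl ss ≋ ss′
  uncons-≋ e zero    = e zero
  uncons-≋ e (suc i) = e (suc i)

  leadingBits-≋ : ∀ ss ss′ → ss ≋ ss′ → leadingBits ss ≡ leadingBits ss′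
  leadingBits-≋ []            []            e = refl
  leadingBits-≋ []            (blank ∷ _)   e = refl
  leadingBits-≋ []            (bit _ ∷ _)   e with () ← e 0
  leadingBits-≋ []            (aux _ ∷ _)   e = refl
  leadingBits-≋ (blank ∷ _)   []            e = refl
  leadingBits-≋ (bit _ ∷ _)   []            e with () ← e 0
  leadingBits-≋ (aux _ ∷ _)   []            e = refl
  leadingBits-≋ (s ∷ ss)      (s′ ∷ ss′)    e with refl ← e 0 | s
  ... | blank = refl
  ... | bit b = cong (b ∷_) (leadingBits-≋ ss ss′ (e ∘ suc))
  ... | aux _ = refl

  halves : Tape g → HalfTapes g
  halves (tape ls s rs) = ls , s ∷ rs

  _≈_ : Tape g → HalfTapes g → Set
  t ≈ (ls , rs) = Tape.before t ≋ ls × Tape.head t ∷ Tape.after t ≋ rs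

  go : Dir → HalfTapes g → HalfTapes g
  go left  (ls , rs) = tl ls , hd ls ∷ᵇ rs
  go stay  (ls , rs) = ls , rs
  go right (ls , rs) = hd rs ∷ᵇ ls , tl rs

  overwrite : Sym g → Dir → HalfTapes g → HalfTapes g
  overwrite s left  (ls , rs) = tl ls , hd ls ∷ᵇ s ∷ᵇ tl rs
  overwrite s stay  (ls , rs) = ls , s ∷ᵇ tl rs
  overwrite s right (ls , rs) = s ∷ᵇ ls , tl rs

  shift-right : ∀ {ls s rs a b} → ls ≋ a → rs ≋ b →
                shift right (tape ls s rs) ≈ (s ∷ᵇ a , b)
  shift-right {rs = []}    p q = ∷-≋ refl p , uncons-≋ q
  shift-right {rs = _ ∷ _} p q = ∷-≋ refl p , q

  shift-left : ∀ {ls s rs a b} → ls ≋ a → s ∷ rs ≋ b →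
               shift left (tape ls s rs) ≈ (tl a , hd a ∷ᵇ b)
  shift-left {ls = []}    p q = p ∘ suc , ∷-≋ (p 0) q
  shift-left {ls = _ ∷ _} p q = p ∘ suc , ∷-≋ (p 0) q

  shift-≈ : ∀ d {t a} → t ≈ a → shift d t ≈ go d a
  shift-≈ left  (p , q) = shift-left p q
  shift-≈ stay  p = p
  shift-≈ right {tape _ s _} {_ , rs} (p , q) rewrite sym (q 0) =
    shift-right p (q ∘ suc)

  write-≈ : ∀ s d {t a} → t ≈ a → shift d (write s t) ≈ overwrite s d a
  write-≈ s left  (p , q) = shift-left p (∷-≋ refl (q ∘ suc))
  write-≈ s stay  (p , q) = p , ∷-≋ refl (q ∘ suc)
  write-≈ s right (p , q) = shift-right p (q ∘ suc)

  ≈-halves : ∀ {t t′ a} → t ≈ a → t′ ≈ a → t ≈ halves t′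
  ≈-halves (p , q) (p′ , q′) =
    (λ i → trans (p i) (sym (p′ i))) , (λ i → trans (q i) (sym (q′ i)))

-- Structured programs and their timed semantics

-- Tape 0 is the oracle tape; `ask i` leaves the answer on tape i.  Symbols
-- other than bits are seen as `nothing`.
data Content (k : ℕ) : Set where
  keep  : Content k
  fixed : Maybe Bool → Content k
  copy  : Fin k → Content k

data Instr (k : ℕ) : Set where
  put    : Fin k → Content k → Dir → Instr k
  ask    : Fin k → Instr k
  switch : Fin k → (Maybe Bool → List (Instr k)) → Instr k
  loop   : (Vec (Maybe Bool) k → Bool) → List (Instr k) → Instr k

Code : ℕ → Set
Code k = List (Instr k)

module _ {g : ℕ} where

  toBit : Sym g → Maybe Bool
  toBit (bit b) = just b
  toBit _       = nothing

  fromBit : Maybe Bool → Sym g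
  fromBit = maybe bit blank

  bits : ∀ {k} → Vec (HalfTapes g) k → Vec (Maybe Bool) k
  bits = Vec.map (toBit ∘ hd ∘ proj₂)

  effect : ∀ {k} → Content k → Dir → Vec (HalfTapes g) k →
           HalfTapes g → HalfTapes g
  effect keep      d ts = go d
  effect (fixed m) d ts = overwrite (fromBit m) d
  effect (copy j)  d ts = overwrite (fromBit (Vec.lookup (bits ts) j)) d

-- Ev φ Q t κ ts: the code κ, started on ts with oracle φ, reaches its end
-- after at most t machine steps, with tapes satisfying Q.
data Ev {g k} (φ : PromiseProblem) (Q : Vec (HalfTapes g) (suc k) → Set) :
        ℕ → Code (suc k) → Vec (HalfTapes g) (suc k) → Set where
  done   : ∀ {t ts} → Q ts → Ev φ Q t [] ts
  wait   : ∀ {t κ ts} → Ev φ Q t κ ts → Ev φ Q (suc t) κ ts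
  put    : ∀ {t κ ts i c d} →
           Ev φ Q t κ (Vec.updateAt ts i (effect c d ts)) →
           Ev φ Q (suc t) (put i c d ∷ κ) ts
  ask    : ∀ {t κ ts i} →
           (∀ y → Answer φ (leadingBits (proj₂ (Vec.head ts))) y →
            Ev φ Q t κ (Vec.updateAt ts i (overwrite (bit y) stay))) →
           Ev φ Q (2 + t) (ask i ∷ κ) ts
  switch : ∀ {t κ ts i P} →
           Ev φ Q t (P (Vec.lookup (bits ts) i) ++ κ) ts →
           Ev φ Q (suc t) (switch i P ∷ κ) ts
  enter  : ∀ {t κ ts c p} → c (bits ts) ≡ true →
           Ev φ Q t (p ++ loop c p ∷ κ) ts → Ev φ Q (suc t) (loop c p ∷ κ) ts
  leave  : ∀ {t κ ts c p} → c (bits ts) ≡ false →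
           Ev φ Q t κ ts → Ev φ Q (suc t) (loop c p ∷ κ) ts

module _ {g k : ℕ} {φ : PromiseProblem} {Q : Vec (HalfTapes g) (suc k) → Set}
  where

  waits : ∀ j {t κ ts} → Ev φ Q t κ ts → Ev φ Q (j + t) κ ts
  waits zero    e = e
  waits (suc j) e = wait (waits j e)

  weaken : ∀ {t t′ κ ts} → t ≤ t′ → Ev φ Q t κ ts → Ev φ Q t′ κ ts
  weaken {t} {t′} t≤t′ e =
    subst (λ t → Ev φ Q t _ _) (m∸n+n≡m t≤t′) (waits (t′ ∸ t) e)

-- Compiling programs to finite control

mutual
  -- The control states are the positions in the program, hence finite by recursion on it. The end
  -- of a code is not a position of its own: `entry` passes on to whatever follows.
  PosI : ∀ {k} → Instr k → Set
  PosI (put i c d)  = ⊤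
  PosI (ask i)      = ⊤ ⊎ Bool
  PosI (switch i P) = ⊤ ⊎ (Pos (P nothing) ⊎ (Pos (P (just false)) ⊎ Pos (P (just true))))
  PosI (loop c p)   = ⊤ ⊎ Pos p

  Pos : ∀ {k} → Code k → Set
  Pos []      = Fin 0
  Pos (p ∷ κ) = PosI p ⊎ Pos κ

Finite : Set → Set
Finite A = ∃ λ q → A ↔ Fin q

⊤-finite : Finite ⊤
⊤-finite = 1 , ↔-sym 1↔⊤

Bool-finite : Finite Bool
Bool-finite = 2 , ↔-sym 2↔Bool

⊎-finite : ∀ {A B} → Finite A → Finite B → Finite (A ⊎ B)
⊎-finite (a , A↔) (b , B↔) = a + b , ↔-sym +↔⊎ ↔-∘ (A↔ ⊎-↔ B↔)

×-finite : ∀ {A B} → Finite A → Finite B → Finite (A × B)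
×-finite (a , A↔) (b , B↔) = a * b , ↔-sym *↔× ↔-∘ (A↔ ×-↔ B↔)

still : ∀ {g n} → Vec (Sym g) n → Vec (Sym g × Dir) n
still = Vec.map (_, stay)

written : ∀ {g k} → Content k → Vec (Sym g) k → Sym g → Sym g
written keep      hs s = s
written (fixed m) hs s = fromBit m
written (copy j)  hs s = fromBit (Vec.lookup (Vec.map toBit hs) j)

inBranch : ∀ {k} i (P : Maybe Bool → Code k) m → Pos (P m) → PosI (switch i P)
inBranch i P nothing      = inj₂ ∘ inj₁
inBranch i P (just false) = inj₂ ∘ inj₂ ∘ inj₁
inBranch i P (just true)  = inj₂ ∘ inj₂ ∘ inj₂

-- ι embeds the control states in those of a larger machine, which goes on in
-- state e.
module _ {k : ℕ} {X : Set} where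

  entryI : (p : Instr k) → (PosI p → X) → X
  entryI (put i c d)  ι = ι tt
  entryI (ask i)      ι = ι (inj₁ tt)
  entryI (switch i P) ι = ι (inj₁ tt)
  entryI (loop c p)   ι = ι (inj₁ tt)

  entry : (κ : Code k) → (Pos κ → X) → X → X
  entry []      ι e = e
  entry (p ∷ κ) ι e = entryI p (ι ∘ inj₁)

  mutual
    stepI : ∀ {g} (p : Instr k) → (PosI p → X) → X →
            PosI p → Vec (Sym g) k → Action X g k
    stepI (put i c d) ι e tt hs =
      move e (Vec.updateAt (still hs) i λ (s , _) → written c hs s , d)
    -- An oracle step cannot write, so the answer is first kept in the state and written in a second
    -- step; hence the cost 2 in `Ev`.
    stepI (ask i) ι e (inj₁ tt) hs = ask (ι ∘ inj₂)
    stepI (ask i) ι e (inj₂ y)  hs =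
      move e (Vec.updateAt (still hs) i λ _ → bit y , stay)
    stepI (switch i P) ι e (inj₁ tt) hs =
      let m = Vec.lookup (Vec.map toBit hs) i
      in move (entry (P m) (ι ∘ inBranch i P m) e) (still hs)
    stepI (switch i P) ι e (inj₂ (inj₁ s)) =
      step (P nothing) (ι ∘ inBranch i P nothing) e s
    stepI (switch i P) ι e (inj₂ (inj₂ (inj₁ s))) =
      step (P (just false)) (ι ∘ inBranch i P (just false)) e s
    stepI (switch i P) ι e (inj₂ (inj₂ (inj₂ s))) =
      step (P (just true)) (ι ∘ inBranch i P (just true)) e s
    stepI (loop c p) ι e (inj₁ tt) hs =
      move (if c (Vec.map toBit hs) then entry p (ι ∘ inj₂) (ι (inj₁ tt)) else e)
           (still hs)
    stepI (loop c p) ι e (inj₂ s) = step p (ι ∘ inj₂) (ι (inj₁ tt)) s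

    step : ∀ {g} (κ : Code k) → (Pos κ → X) → X →
           Pos κ → Vec (Sym g) k → Action X g k
    step (p ∷ κ) ι e (inj₁ s) = stepI p (ι ∘ inj₁) (entry κ (ι ∘ inj₂) e) s
    step (p ∷ κ) ι e (inj₂ s) = step κ (ι ∘ inj₂) e s

mutual
  PosI-finite : ∀ {k} (p : Instr k) → Finite (PosI p)
  PosI-finite (put i c d)  = ⊤-finite
  PosI-finite (ask i)      = ⊎-finite ⊤-finite Bool-finite
  PosI-finite (switch i P) =
    ⊎-finite ⊤-finite (⊎-finite (Pos-finite (P nothing))
      (⊎-finite (Pos-finite (P (just false))) (Pos-finite (P (just true)))))
  PosI-finite (loop c p)   = ⊎-finite ⊤-finite (Pos-finite p)

  Pos-finite : ∀ {k} (κ : Code k) → Finite (Pos κ)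
  Pos-finite []      = 0 , ↔-id _
  Pos-finite (p ∷ κ) = ⊎-finite (PosI-finite p) (Pos-finite κ)

-- Moving several tapes at once

take-++ : ∀ {A : Set} {m n} (xs : Vec A m) (ys : Vec A n) →
          Vec.take m (xs Vec.++ ys) ≡ xs
take-++ []       ys = refl
take-++ (x ∷ xs) ys = cong (x ∷_) (take-++ xs ys)

drop-++ : ∀ {A : Set} {m n} (xs : Vec A m) (ys : Vec A n) →
          Vec.drop m (xs Vec.++ ys) ≡ ys
drop-++ []       ys = refl
drop-++ (x ∷ xs) ys = drop-++ xs ys

replicate-++ : ∀ {A : Set} m {n} (x : A) →
               Vec.replicate (m + n) x ≡ Vec.replicate m x Vec.++ Vec.replicate n x
replicate-++ zero    x = refl
replicate-++ (suc m) x = cong (x ∷_) (replicate-++ m x)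

module _ {g : ℕ} where

  heads : ∀ {n} → Vec (Tape g) n → Vec (Sym g) n
  heads = Vec.map Tape.head

  toBit-heads : ∀ {n} {ts : Vec (Tape g) n} {as} → Pointwise _≈_ ts as →
                Vec.map toBit (heads ts) ≡ bits as
  toBit-heads []             = refl
  toBit-heads ((_ , q) ∷ ps) = cong₂ _∷_ (cong toBit (q 0)) (toBit-heads ps)

  -- `moveTo` acts by an anonymous function, which is not definitionally equal
  -- to any other; hence an arbitrary f with the same values.
  Acts : (Sym g × Dir → Tape g → Tape g) → Set
  Acts f = ∀ s d t → f (s , d) t ≡ shift d (write s t)

  module _ {f : Sym g × Dir → Tape g → Tape g} (f≡ : Acts f) where

    zipWith-still : ∀ {n} (ts : Vec (Tape g) n) →
                    Vec.zipWith f (still (heads ts)) ts ≡ ts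
    zipWith-still []       = refl
    zipWith-still (t ∷ ts) =
      cong₂ _∷_ (f≡ (Tape.head t) stay t) (zipWith-still ts)

    zipWith-update : ∀ {n} i {w : Sym g × Dir → Sym g × Dir} {e} →
      (∀ {t a} → t ≈ a → f (w (Tape.head t , stay)) t ≈ e a) →
      {ts : Vec (Tape g) n} {as : Vec (HalfTapes g) n} → Pointwise _≈_ ts as →
      Pointwise _≈_ (Vec.zipWith f (Vec.updateAt (still (heads ts)) i w) ts)
                    (Vec.updateAt as i e)
    zipWith-update zero    h {_ ∷ ts} (p ∷ ps) rewrite zipWith-still ts = h p ∷ ps
    zipWith-update (suc i) h {t ∷ _}  (p ∷ ps)
      rewrite f≡ (Tape.head t) stay t = p ∷ zipWith-update i h ps

    effect-≈ : ∀ {n} i c d {ts : Vec (Tape g) n} {as : Vec (HalfTapes g) n} →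
      Pointwise _≈_ ts as →
      Pointwise _≈_
        (Vec.zipWith f (Vec.updateAt (still (heads ts)) i
                          λ (s , _) → written c (heads ts) s , d) ts)
        (Vec.updateAt as i (effect c d as))
    effect-≈ i c d {ts} {as} ps = zipWith-update i (go′ c) ps
      where
      go′ : ∀ c {t a} → t ≈ a →
            f (written c (heads ts) (Tape.head t) , d) t ≈ effect c d as a
      go′ c        {t} p rewrite f≡ (written c (heads ts) (Tape.head t)) d t
        with c
      ... | keep    = shift-≈ d p
      ... | fixed m = write-≈ (fromBit m) d p
      ... | copy j rewrite toBit-heads ps = write-≈ _ d p

AllPaths-≤ : ∀ {M φ S t t′ c} → t ≤ t′ → AllPaths M φ S t c → AllPaths M φ S t′ c
AllPaths-≤ t≤         (halts a y) = halts a y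
AllPaths-≤ (s≤s t≤) (moves a p) = moves a (AllPaths-≤ t≤ p)
AllPaths-≤ (s≤s t≤) (asks a p)  = asks a λ y y∈ → AllPaths-≤ t≤ (p y y∈)

-- Closure properties of polynomials

IsPoly : (ℕ → ℕ) → Set
IsPoly f = ∃ λ p → ∀ n → f n ≡ evalPoly p n

poly-const : ∀ c → IsPoly (λ _ → c)
poly-const c = c ∷ [] , λ n → sym (trans (cong (c +_) (*-zeroʳ n)) (+-identityʳ c))

poly-+ : ∀ {f h} → IsPoly f → IsPoly h → IsPoly (λ n → f n + h n)
poly-+ (p , f≡) (q , h≡) =
  add p q , λ n → trans (cong₂ _+_ (f≡ n) (h≡ n)) (sym (eval-add p q n))
  where
  add : List ℕ → List ℕ → List ℕ
  add []      q       = q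
  add (a ∷ p) []      = a ∷ p
  add (a ∷ p) (b ∷ q) = a + b ∷ add p q

  eval-add : ∀ p q n → evalPoly (add p q) n ≡ evalPoly p n + evalPoly q n
  eval-add []      q       n = refl
  eval-add (a ∷ p) []      n = sym (+-identityʳ _)
  eval-add (a ∷ p) (b ∷ q) n rewrite eval-add p q n =
    solve 5 (λ a b n u v → (a :+ b) :+ n :* (u :+ v) := (a :+ n :* u) :+ (b :+ n :* v))
          refl a b n (evalPoly p n) (evalPoly q n)

poly-n* : ∀ {f} → IsPoly f → IsPoly (λ n → n * f n)
poly-n* (p , f≡) = 0 ∷ p , λ n → cong (n *_) (f≡ n)

poly-id : IsPoly (λ n → n)
poly-id with poly-n* (poly-const 1)
... | p , eq = p , λ n → trans (sym (*-identityʳ n)) (eq n)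

poly-≗ : ∀ {f h} → (∀ n → f n ≡ h n) → IsPoly f → IsPoly h
poly-≗ f≗h (p , f≡) = p , λ n → trans (sym (f≗h n)) (f≡ n)

poly-c* : ∀ c {f} → IsPoly f → IsPoly (λ n → c * f n)
poly-c* zero    pf = poly-const 0
poly-c* (suc c) pf = poly-+ pf (poly-c* c pf)

poly-* : ∀ {f h} → IsPoly f → IsPoly h → IsPoly (λ n → f n * h n)
poly-* {h = h} (p , f≡) ph = poly-≗ (λ n → cong (_* h n) (sym (f≡ n))) (go′ p)
  where
  go′ : ∀ p → IsPoly (λ n → evalPoly p n * h n)
  go′ []      = poly-const 0
  go′ (a ∷ p) = poly-≗
    (λ n → sym (trans (*-distribʳ-+ (h n) a (n * evalPoly p n))
                      (cong (a * h n +_) (*-assoc n (evalPoly p n) (h n)))))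
    (poly-+ (poly-c* a ph) (poly-n* (go′ p)))

poly-∘ : ∀ {f h} → IsPoly f → IsPoly h → IsPoly (λ n → f (h n))
poly-∘ {h = h} (p , f≡) ph = poly-≗ (λ n → sym (f≡ (h n))) (go′ p)
  where
  go′ : ∀ p → IsPoly (λ n → evalPoly p (h n))
  go′ []      = poly-const 0
  go′ (a ∷ p) = poly-+ (poly-const a) (poly-* ph (go′ p))

poly-mono : ∀ {f} → IsPoly f → ∀ {m n} → m ≤ n → f m ≤ f n
poly-mono (p , f≡) {m} {n} m≤n =
  ≤-trans (≤-reflexive (f≡ m)) (≤-trans (go′ p) (≤-reflexive (sym (f≡ n))))
  where
  go′ : ∀ p → evalPoly p m ≤ evalPoly p n
  go′ []      = z≤n
  go′ (a ∷ p) = +-monoʳ-≤ a (*-mono-≤ m≤n (go′ p))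

-- Inlining a subroutine into an oracle machine

-- A φ₁-query is answered by a program for the tapes 0 (oracle), 1 (holding
-- the query), 2 (on which the answer is left) and k more.
record Subroutine (φ₁ φ₂ : PromiseProblem) : Set₁ where
  field
    {k}  : ℕ
    code : Code (3 + k)
    time : ℕ → ℕ
    time-poly : IsPoly time

  Result : ∀ {g} → List (Sym g) → List (Sym g) → Vec (HalfTapes g) (3 + k) → Set
  Result ls rs ts = ∃ λ y → Answer φ₁ (leadingBits rs) y ×
    ts ≡ ([] , []) ∷ (ls , rs) ∷ ([] , bit y ∷ []) ∷ Vec.replicate k ([] , [])

  field
    -- The alphabet is that of the calling machine, and the tape with the query may hold anything
    -- before and after it.
    correct : ∀ {g} (ls rs : List (Sym g)) →
      Ev φ₂ (Result ls rs) (time (length (leadingBits rs))) code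
         (([] , []) ∷ (ls , rs) ∷ ([] , []) ∷ Vec.replicate k ([] , []))

module Simulation {φ₁ φ₂ : PromiseProblem} (sub : Subroutine φ₁ φ₂) (M : OracleTM) where
  open Subroutine sub
  module M = OracleTM M

  g : ℕ
  g = M.extra

  work′ tapes′ : ℕ
  work′ = 2 + k + M.work
  tapes′ = 2 + work′

  -- A subroutine call remembers the states in which M continues on the
  -- answers 1 and 0.
  Caller State′ : Set
  Caller = M.State × M.State
  State′ = M.State ⊎ (Caller × (⊤ ⊎ Pos code))

  inCode : Caller → Pos code → State′
  inCode q s = inj₂ (q , inj₂ s)

  exit : Caller → State′
  exit q = inj₂ (q , inj₁ tt)

  call : (Bool → M.State) → State′
  call r = entry code (inCode (r true , r false)) (exit (r true , r false))

  pad : ∀ {m} → Sym g → Vec (Sym g) m → Action State′ g (3 + k) →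
        Action State′ g (suc (3 + k + m))
  pad h hw (halt y)    = halt y
  pad h hw (move q ws) = move q ((h , stay) ∷ ws Vec.++ still hw)
  pad h hw (ask r)     = ask r

  return : Caller → Maybe Bool → M.State
  return (q₁ , q₀) (just true) = q₁
  return (q₁ , q₀) _           = q₀

  control : Caller → ⊤ ⊎ Pos code → Vec (Sym g) (3 + k) → Action State′ g (3 + k)
  control q (inj₁ tt) hs =
    -- The answer passes from its tape into the state of M, and the tape is blanked for the next
    -- call.
    move (inj₁ (return q (Vec.lookup (Vec.map toBit hs) (suc (suc zero)))))
         (Vec.updateAt (still hs) (suc (suc zero)) λ _ → blank , stay)
  control q (inj₂ s) hs = step code (inCode q) (exit q) s hs

  -- The order of the tapes is: input, oracle tape of the new machine, former oracle tape of M, the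
  -- other tapes of the subroutine, work tapes of M.
  resume : Sym g → Sym g → Sym g → Vec (Sym g) (suc k) → Vec (Sym g) M.work →
           Action M.State g M.tapes → Action State′ g tapes′
  resume h ho hq hs hw (halt y)                = halt y
  resume h ho hq hs hw (move q (w ∷ wq ∷ ww)) =
    move (inj₁ q) (w ∷ (ho , stay) ∷ wq ∷ still hs Vec.++ ww)
  resume h ho hq hs hw (ask r)                 =
    move (call r) (still (h ∷ ho ∷ hq ∷ hs Vec.++ hw))

  δ′ : State′ → Vec (Sym g) tapes′ → Action State′ g tapes′
  δ′ (inj₁ q) (h ∷ ho ∷ hq ∷ hr) =
    resume h ho hq (Vec.take (suc k) hr) (Vec.drop (suc k) hr)
           (M.δ q (h ∷ hq ∷ Vec.drop (suc k) hr))
  δ′ (inj₂ (q , s)) (h ∷ hr) =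
    pad h (Vec.drop (3 + k) hr) (control q s (Vec.take (3 + k) hr))

  M′ : OracleTM
  M′ = record
    { State  = State′
    ; finite = ⊎-finite M.finite calls-finite
    ; extra  = g
    ; work   = work′
    ; start  = inj₁ M.start
    ; δ      = δ′
    }
    where
    calls-finite : Finite (Caller × (⊤ ⊎ Pos code))
    calls-finite = ×-finite (×-finite M.finite M.finite)
                             (⊎-finite ⊤-finite (Pos-finite code))

  module M′ = OracleTM M′

  δ′-call : ∀ q s h (hs : Vec (Sym g) (3 + k)) (hw : Vec (Sym g) M.work) →
    δ′ (inj₂ (q , s)) (h ∷ hs Vec.++ hw) ≡ pad h hw (control q s hs)
  δ′-call q s h hs hw
    rewrite take-++ hs hw | drop-++ hs hw = refl

  δ′-resume : ∀ q h ho hq (hs : Vec (Sym g) (suc k)) (hw : Vec (Sym g) M.work) →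
    δ′ (inj₁ q) (h ∷ ho ∷ hq ∷ hs Vec.++ hw) ≡ resume h ho hq hs hw (M.δ q (h ∷ hq ∷ hw))
  δ′-resume q h ho hq hs hw
    rewrite take-++ hs hw | drop-++ hs hw = refl

  Runs : State′ → (Vec (Sym g) (3 + k) → Action State′ g (3 + k)) → Set
  Runs s a = ∀ h (hs : Vec (Sym g) (3 + k)) (hw : Vec (Sym g) M.work) →
             δ′ s (h ∷ hs Vec.++ hw) ≡ pad h hw (a hs)

  module Call (q : Caller) (t₀ : Tape g) (ws : Vec (Tape g) M.work) where

    config : State′ → Vec (Tape g) (3 + k) → M′.Config
    config s ts = s , t₀ ∷ ts Vec.++ ws

    -- The state s continues with code κ and then with the exit.
    data At : Code (3 + k) → State′ → Set where
      end  : At [] (exit q)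
      next : ∀ {p κ e} (ι : PosI p → State′) →
             (∀ s → Runs (ι s) (stepI p ι e s)) →
             At κ e → At (p ∷ κ) (entryI p ι)

    at-++ : ∀ c {κ e} (ι : Pos c → State′) →
      (∀ s → Runs (ι s) (step c ι e s)) →
      At κ e → At (c ++ κ) (entry c ι e)
    at-++ []      ι eq a = a
    at-++ (p ∷ c) ι eq a =
      next (ι ∘ inj₁) (eq ∘ inj₁) (at-++ c (ι ∘ inj₂) (eq ∘ inj₂) a)

    at-code : At (code ++ []) (entry code (inCode q) (exit q))
    at-code = at-++ code (inCode q) (λ s → δ′-call q (inj₂ s)) end

    action-at : ∀ s ts {a : Vec (Sym g) (3 + k) → Action State′ g (3 + k)} →
      Runs s a →
      M′.action (config s ts) ≡ pad (Tape.head t₀) (heads ws) (a (heads ts))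
    action-at s ts eq = trans
      (cong (λ v → δ′ s (Tape.head t₀ ∷ v)) (map-++ Tape.head ts ws))
      (eq (Tape.head t₀) (heads ts) (heads ws))

    module _ {S : P₊} where

      move-at : ∀ {s} ts {as : Vec (HalfTapes g) (3 + k)} {e t}
        {v : Vec (Sym g × Dir) (3 + k)} →
        M′.action (config s ts) ≡ pad (Tape.head t₀) (heads ws) (move e v) →
        (∀ {f} → Acts f →
           Pointwise _≈_ (Vec.zipWith f v ts) as) →
        (∀ {ts′} → Pointwise _≈_ ts′ as → AllPaths M′ φ₂ S t (config e ts′)) →
        AllPaths M′ φ₂ S (suc t) (config s ts)
      move-at ts {e = e} {t} {v} eq ≈as k = moves eq (moved (λ _ _ _ → refl))
        where
        moved : ∀ {f} → Acts f →
          AllPaths M′ φ₂ S t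
            (e , t₀ ∷ Vec.zipWith f (v Vec.++ still (heads ws)) (ts Vec.++ ws))
        moved {f} f≡
          rewrite zipWith-++ f v (still (heads ws)) ts ws | zipWith-still f≡ ws =
          k (≈as f≡)

      still-≈ : ∀ {ts : Vec (Tape g) (3 + k)} {as : Vec (HalfTapes g) (3 + k)} →
        Pointwise _≈_ ts as →
        ∀ {f} → Acts f →
        Pointwise _≈_ (Vec.zipWith f (still (heads ts)) ts) as
      still-≈ {ts} {as} ps {f} f≡ =
        subst (λ u → Pointwise _≈_ u as) (sym (zipWith-still f≡ ts)) ps

      -- Both sides see the tapes only through their heads and the query, on which `≈` forces
      -- agreement. So each rule of `Ev` is matched by machine steps, and `r` is the time left after
      -- the exit.
      sound : ∀ {r Q κ s t as ts} → Ev φ₂ Q t κ as → At κ s → Pointwise _≈_ ts as →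
        (∀ {ts′ as′} → Q as′ → Pointwise _≈_ ts′ as′ →
           AllPaths M′ φ₂ S r (config (exit q) ts′)) →
        AllPaths M′ φ₂ S (t + r) (config s ts)
      sound {r} {t = t} (done x) end ps k = AllPaths-≤ (m≤n+m r t) (k x ps)
      sound (wait ev) at ps k = AllPaths-≤ (n≤1+n _) (sound ev at ps k)
      sound {ts = ts} (put {i = i} {c} {d} ev) (next ι eq at) ps k =
        move-at ts (action-at (ι tt) ts (eq tt)) (λ f≡ → effect-≈ f≡ i c d ps)
          λ ps′ → sound ev at ps′ k
      sound {ts = t ∷ ts} (ask {ts = (_ , rs) ∷ _} {i = i} ev) (next ι eq at) (p ∷ ps) k =
        asks (action-at (ι (inj₁ tt)) (t ∷ ts) (eq (inj₁ tt))) λ y y∈ →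
          move-at (t ∷ ts) (action-at (ι (inj₂ y)) (t ∷ ts) (eq (inj₂ y)))
            (λ f≡ → zipWith-update f≡ i
              (λ {t} p → subst (_≈ _) (sym (f≡ (bit y) stay t)) (write-≈ (bit y) stay p))
              (p ∷ ps))
            λ ps′ → sound
              (ev y (subst (λ u → Answer φ₂ u y)
                           (leadingBits-≋ (Tape.head t ∷ Tape.after t) rs (proj₂ p)) y∈))
              at ps′ k
      sound {ts = ts} (switch {κ = κ} {i = i} {P} ev) (next {e = e} ι eq at) ps k =
        move-at ts (action-at (ι (inj₁ tt)) ts (eq (inj₁ tt))) (λ f≡ → still-≈ ps f≡)
          λ {ts′} ps′ → sound ev
            (subst (λ v → At (P (Vec.lookup v i) ++ _)
                             (entry (P (Vec.lookup (Vec.map toBit (heads ts)) i)) _ _))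
                   (toBit-heads ps)
                   (at-branch (Vec.lookup (Vec.map toBit (heads ts)) i))) ps′ k
        where
        at-branch : ∀ m → At (P m ++ κ) (entry (P m) (ι ∘ inBranch i P m) e)
        at-branch nothing = at-++ (P nothing) _ (λ s → eq (inj₂ (inj₁ s))) at
        at-branch (just false) =
          at-++ (P (just false)) _ (λ s → eq (inj₂ (inj₂ (inj₁ s)))) at
        at-branch (just true) =
          at-++ (P (just true)) _ (λ s → eq (inj₂ (inj₂ (inj₂ s)))) at
      sound {ts = ts} (enter {c = c} {p} ct ev) at′@(next {e = e} ι eq at) ps k =
        move-at ts (trans (action-at (ι (inj₁ tt)) ts (eq (inj₁ tt)))
                     (cong (λ b → pad (Tape.head t₀) (heads ws)
                              (move (if b then entry p (ι ∘ inj₂) (ι (inj₁ tt)) else e)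
                                    (still (heads ts))))
                       (trans (cong c (toBit-heads ps)) ct)))
          (λ f≡ → still-≈ ps f≡)
          λ ps′ → sound ev (at-++ p (ι ∘ inj₂) (λ s → eq (inj₂ s)) at′) ps′ k
      sound {ts = ts} (leave {c = c} {p} cf ev) (next {e = e} ι eq at) ps k =
        move-at ts (trans (action-at (ι (inj₁ tt)) ts (eq (inj₁ tt)))
                     (cong (λ b → pad (Tape.head t₀) (heads ws)
                              (move (if b then entry p (ι ∘ inj₂) (ι (inj₁ tt)) else e)
                                    (still (heads ts))))
                       (trans (cong c (toBit-heads ps)) cf)))
          (λ f≡ → still-≈ ps f≡)
          λ ps′ → sound ev at ps′ k

  size : Tape g → ℕ
  size (tape ls _ rs) = suc (length ls + length rs)

  size-shift : ∀ d s t → size (shift d (write s t)) ≤ suc (size t)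
  size-shift left  s (tape []       _ rs) = ≤-refl
  size-shift left  s (tape (_ ∷ ls) _ rs)
    rewrite +-suc (length ls) (length rs) = n≤1+n _
  size-shift stay  s t = n≤1+n _
  size-shift right s (tape ls _ [])       = ≤-refl
  size-shift right s (tape ls _ (_ ∷ rs))
    rewrite +-suc (length ls) (length rs) = n≤1+n _

  leadingBits-length : ∀ (ss : List (Sym g)) → length (leadingBits ss) ≤ length ss
  leadingBits-length []           = z≤n
  leadingBits-length (blank ∷ _)  = z≤n
  leadingBits-length (bit _ ∷ ss) = s≤s (leadingBits-length ss)
  leadingBits-length (aux _ ∷ _)  = z≤n

  contents-size : ∀ t → length (contents t) ≤ size t
  contents-size (tape ls s rs) =
    ≤-trans (leadingBits-length (s ∷ rs)) (s≤s (m≤n+m (length rs) (length ls)))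

  idle : Tape g → Vec (HalfTapes g) (3 + k)
  idle tq = ([] , []) ∷ halves tq ∷ ([] , []) ∷ Vec.replicate k ([] , [])

  action-resume : ∀ q t₀ to tq tq′ (ts : Vec (Tape g) (suc k)) ws →
    Tape.head tq′ ≡ Tape.head tq →
    M′.action (inj₁ q , t₀ ∷ to ∷ tq′ ∷ ts Vec.++ ws) ≡
    resume (Tape.head t₀) (Tape.head to) (Tape.head tq′) (heads ts) (heads ws)
           (M.action (q , t₀ ∷ tq ∷ ws))
  action-resume q t₀ to tq tq′ ts ws eq
    rewrite map-++ Tape.head ts ws | sym eq =
    δ′-resume q (Tape.head t₀) (Tape.head to) (Tape.head tq′) (heads ts) (heads ws)

  zipWith-cong : ∀ {f f′} → Acts f → Acts f′ →
    ∀ {n} v (ts : Vec (Tape g) n) → Vec.zipWith f v ts ≡ Vec.zipWith f′ v ts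
  zipWith-cong f≡ f′≡ []            []       = refl
  zipWith-cong f≡ f′≡ ((s , d) ∷ v) (t ∷ ts) =
    cong₂ _∷_ (trans (f≡ s d t) (sym (f′≡ s d t))) (zipWith-cong f≡ f′≡ v ts)

  module _ {S : P₊} (T : ℕ) where

    -- A step of M uses up one unit of `t` and enlarges the tape by at most one cell, so the sum
    -- stays below `T` and every query is at most that long. Each step of M costs at most
    -- `2 + time T`: one step to enter the subroutine, its run, and one step to collect the answer.
    simulate : ∀ {t q t₀ tq ws} (ts : Vec (Tape g) (3 + k)) →
      size tq + t ≤ T → AllPaths M φ₁ S t (q , t₀ ∷ tq ∷ ws) →
      Pointwise _≈_ ts (idle tq) →
      AllPaths M′ φ₂ S (t * (2 + time T)) (inj₁ q , t₀ ∷ ts Vec.++ ws)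
    simulate {q = q} {t₀} {tq} {ws} (to ∷ tq′ ∷ ts) sz (halts a y∈) (_ ∷ p ∷ _) =
      halts (trans (action-resume q t₀ to tq tq′ ts ws (proj₂ p 0))
                   (cong (resume _ _ _ (heads ts) (heads ws)) a)) y∈
    simulate {suc t} {q} {t₀} {tq} {ws} (to ∷ tq′ ∷ ts) sz
             (moves {q = q′} {ws = w ∷ (s , d) ∷ ww} a paths) (po ∷ p ∷ ps) =
      moves (trans (action-resume q t₀ to tq tq′ ts ws (proj₂ p 0))
                   (cong (resume _ _ _ (heads ts) (heads ws)) a))
            (AllPaths-≤ (m≤n+m _ (suc (time T)))
              (moved (λ _ _ _ → refl) (λ _ _ _ → refl) paths))
      where
      moved : ∀ {f f′} → Acts f → Acts f′ →
        AllPaths M φ₁ S t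
          (q′ , f w t₀ ∷ shift d (write s tq) ∷ Vec.zipWith f ww ws) →
        AllPaths M′ φ₂ S (t * (2 + time T))
          (inj₁ q′ , f′ w t₀ ∷ to ∷ shift d (write s tq′) ∷
                     Vec.zipWith f′ (still (heads ts) Vec.++ ww) (ts Vec.++ ws))
      moved {f} {f′} f≡ f′≡ paths
        rewrite zipWith-++ f′ (still (heads ts)) ww ts ws
              | zipWith-still f′≡ ts
              | f′≡ (proj₁ w) (proj₂ w) t₀ | sym (f≡ (proj₁ w) (proj₂ w) t₀)
              | zipWith-cong f′≡ f≡ ww ws =
        simulate (to ∷ shift d (write s tq′) ∷ ts)
          (≤-trans (+-monoˡ-≤ t (size-shift d s tq))
                   (≤-trans (≤-reflexive (sym (+-suc (size tq) t))) sz))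
          paths
          (po ∷ ≈-halves {a = overwrite s d (halves tq)} (write-≈ s d p)
                  (write-≈ s d {tq} ((λ _ → refl) , λ _ → refl)) ∷ ps)
    simulate {suc t} {q} {t₀} {tq} {ws} (to ∷ tq′ ∷ ts) sz
             (asks {r = r} a paths) ps@(po ∷ p ∷ _) =
      move-at′ (AllPaths-≤ bound
        (sound (correct (Tape.before tq) (Tape.head tq ∷ Tape.after tq))
               (subst (λ κ → At κ (call r)) (++-identityʳ code) at-code) ps returned))
      where
      open Call (r true , r false) t₀ ws

      bound : time (length (contents tq)) + suc (t * (2 + time T)) ≤
              suc (time T + t * (2 + time T))
      bound = ≤-trans (≤-reflexive (+-suc _ _)) (s≤s (+-monoˡ-≤ _
        (poly-mono time-poly (≤-trans (contents-size tq) (≤-trans (m≤m+n (size tq) (suc t)) sz)))))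

      move-at′ : AllPaths M′ φ₂ S (suc (time T + t * (2 + time T)))
                   (config (call r) (to ∷ tq′ ∷ ts)) →
                 AllPaths M′ φ₂ S (2 + time T + t * (2 + time T))
                   (inj₁ q , t₀ ∷ to ∷ tq′ ∷ ts Vec.++ ws)
      move-at′ paths′ =
        moves (trans (action-resume q t₀ to tq tq′ ts ws (proj₂ p 0))
                     (cong (resume _ _ _ (heads ts) (heads ws)) a))
              (stilled (λ _ _ _ → refl))
        where
        stilled : ∀ {f} → Acts f →
          AllPaths M′ φ₂ S (suc (time T + t * (2 + time T)))
            (call r , t₀ ∷ to ∷ tq′ ∷
              Vec.zipWith f (still (heads ts Vec.++ heads ws)) (ts Vec.++ ws))
        stilled f≡ rewrite sym (map-++ Tape.head ts ws) | zipWith-still f≡ (ts Vec.++ ws) = paths′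

      returned : ∀ {ts′ as} →
        Result (Tape.before tq) (Tape.head tq ∷ Tape.after tq) as →
        Pointwise _≈_ ts′ as →
        AllPaths M′ φ₂ S (suc (t * (2 + time T)))
          (config (exit (r true , r false)) ts′)
      returned {to ∷ tq′ ∷ t ∷ ts} (y , y∈ , refl) ps@(po ∷ p ∷ pd ∷ pr) =
        move-at (to ∷ tq′ ∷ t ∷ ts)
          (action-at (exit (r true , r false)) (to ∷ tq′ ∷ t ∷ ts)
            (δ′-call (r true , r false) (inj₁ tt)))
          (λ f≡ → zipWith-update f≡ (suc (suc zero))
            {w = λ _ → blank , stay} {e = overwrite blank stay}
            (λ {t} p → subst (_≈ _) (sym (f≡ blank stay t)) (write-≈ blank stay p)) ps)
          (λ {ts″} ps″ → simulate ts″ (≤-trans (+-monoʳ-≤ (size tq) (n≤1+n _)) sz)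
             (subst (λ q → AllPaths M φ₁ S _ (q , t₀ ∷ tq ∷ ws))
                    (answered y (proj₂ pd 0)) (paths y y∈)) ps″)
        where
        answered : ∀ y {s} → s ≡ bit y → r y ≡ return (r true , r false) (toBit s)
        answered false refl = refl
        answered true  refl = refl

P̂-⊆ : ∀ {φ₁ φ₂} → Subroutine φ₁ φ₂ → P̂ φ₁ ⊆ P̂ φ₂
P̂-⊆ {φ₁} {φ₂} sub {φ} (M , p , M-decides) =
  M′ , proj₁ poly , λ x →
    AllPaths-≤ (≤-reflexive (proj₂ poly (List⁺.length x)))
      -- The `1` is the size of the initial blank oracle tape.
      (started x (simulate (1 + evalPoly p (List⁺.length x))
        {tq = blankTape} {ws = Vec.replicate M.work blankTape}
        (Vec.replicate (3 + k) blankTape) ≤-refl (M-decides x) idle₀))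
  where
  open Subroutine sub
  open Simulation sub M

  poly : IsPoly (λ n → evalPoly p n * (2 + time (1 + evalPoly p n)))
  poly = poly-* (p , λ _ → refl)
    (poly-+ (poly-const 2) (poly-∘ time-poly (poly-+ (poly-const 1) (p , λ _ → refl))))

  started : ∀ x {t} → AllPaths M′ φ₂ (φ x) t
      (inj₁ M.start , inputTape x ∷
        Vec.replicate (3 + k) blankTape Vec.++ Vec.replicate M.work blankTape) →
    AllPaths M′ φ₂ (φ x) t (M′.initial x)
  started x {t} = subst (λ ts → AllPaths M′ φ₂ (φ x) t (inj₁ M.start , inputTape x ∷ ts))
                        (sym (replicate-++ (3 + k) blankTape))

  blank-≈ : blankTape {g} ≈ ([] , [])
  blank-≈ = (λ _ → refl) , λ { zero → refl ; (suc _) → refl }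

  idle₀ : Pointwise _≈_ (Vec.replicate (3 + k) blankTape) (idle blankTape)
  idle₀ = blank-≈ ∷ ((λ _ → refl) , (λ _ → refl)) ∷ blank-≈ ∷ all-blank k
    where
    all-blank : ∀ k → Pointwise _≈_ (Vec.replicate k blankTape) (Vec.replicate k ([] , []))
    all-blank zero    = []
    all-blank (suc k) = blank-≈ ∷ all-blank k

-- Games with infinite blocks

Assignment : ℕ → Set
Assignment n = Fin n → ℕ → Bool

-- The games of Sat and CoSat with infinite blocks, so that substitutions
-- need not respect block lengths.
mutual
  Ex : ∀ n → (Assignment n → Bool) → Set
  Ex zero    h = ∀ ρ → T (h ρ)
  Ex (suc n) h = ∃ λ a → Al n (λ ρ → h (a Vector.∷ ρ))

  Al : ∀ n → (Assignment n → Bool) → Set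
  Al zero    h = ∀ ρ → T (h ρ)
  Al (suc n) h = ∀ a → Ex n (λ ρ → h (a Vector.∷ ρ))

mutual
  Ex-mono : ∀ n {h h′ : Assignment n → Bool} →
            (∀ ρ → T (h ρ) → T (h′ ρ)) → Ex n h → Ex n h′
  Ex-mono zero    f e       = λ ρ → f ρ (e ρ)
  Ex-mono (suc n) f (a , w) = a , Al-mono n (λ ρ → f (a Vector.∷ ρ)) w

  Al-mono : ∀ n {h h′ : Assignment n → Bool} →
            (∀ ρ → T (h ρ) → T (h′ ρ)) → Al n h → Al n h′
  Al-mono zero    f w = λ ρ → f ρ (w ρ)
  Al-mono (suc n) f w = λ a → Ex-mono n (λ ρ → f (a Vector.∷ ρ)) (w a)

Ex-≗ : ∀ n {h h′ : Assignment n → Bool} → (∀ ρ → h ρ ≡ h′ ρ) → Ex n h → Ex n h′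
Ex-≗ n h≗h′ = Ex-mono n (λ ρ → subst T (h≗h′ ρ))

Al-≗ : ∀ n {h h′ : Assignment n → Bool} → (∀ ρ → h ρ ≡ h′ ρ) → Al n h → Al n h′
Al-≗ n h≗h′ = Al-mono n (λ ρ → subst T (h≗h′ ρ))

mutual
  -- A property of the first block that the matrix enforces can be read off a single winning play;
  -- zeros serve as the moves of the opponent.
  Ex-play : ∀ n {h : Assignment n → Bool} → Ex n h → ∃ λ ρ → T (h ρ)
  Ex-play zero    e = let ρ = λ () in ρ , e ρ
  Ex-play (suc n) (a , w) with Al-play n w
  ... | ρ , t = a Vector.∷ ρ , t

  Al-play : ∀ n {h : Assignment n → Bool} → Al n h → ∃ λ ρ → T (h ρ)
  Al-play zero    w = let ρ = λ () in ρ , w ρ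
  Al-play (suc n) w with Ex-play n (w λ _ → false)
  ... | ρ , t = (λ _ → false) Vector.∷ ρ , t

T-not : ∀ b → T (not b) → ¬ T b
T-not true  ()
T-not false _ ()

¬T⇒T-not : ∀ b → ¬ T b → T (not b)
¬T⇒T-not true  ¬t = ¬t tt
¬T⇒T-not false ¬t = tt

mutual
  -- The two strategies are played against each other, and the resulting assignment would make `h`
  -- both true and false.
  Ex-not : ∀ n {h : Assignment n → Bool} → Ex n (not ∘ h) → ¬ Al n h
  Ex-not zero    {h} e       w = T-not (h ρ₀) (e ρ₀) (w ρ₀)
    where
    ρ₀ : Assignment 0
    ρ₀ ()
  Ex-not (suc n) (a , w′) w = Al-not n w′ (w a)

  Al-not : ∀ n {h : Assignment n → Bool} → Al n (not ∘ h) → ¬ Ex n h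
  Al-not zero        w e        = Ex-not zero w e
  Al-not (suc n) w (a , w′) = Ex-not n (w a) w′

-- Truncating an infinite block, or padding a finite one by the default of `lookup₀`, is harmless
-- only for functions that do not look past the block length.
Local : ∀ {n} → Vec ℕ n → (Assignment n → Bool) → Set
Local ks h = ∀ {ρ ρ′} → (∀ i j → j ≤ Vec.lookup ks i → ρ i j ≡ ρ′ i j) → h ρ ≡ h ρ′

local-tail : ∀ {n k} {ks : Vec ℕ n} {h} → Local (k ∷ ks) h →
             ∀ a → Local ks (λ ρ → h (a Vector.∷ ρ))
local-tail loc a ρ≡ = loc λ { zero j j≤ → refl ; (suc i) j j≤ → ρ≡ i j j≤ }

local-head : ∀ {n k} {ks : Vec ℕ n} {h} → Local (k ∷ ks) h →
             ∀ {a a′} → (∀ j → j ≤ k → a j ≡ a′ j) →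
             ∀ ρ → h (a Vector.∷ ρ) ≡ h (a′ Vector.∷ ρ)
local-head loc a≡ ρ = loc λ { zero j j≤ → a≡ j j≤ ; (suc i) j j≤ → refl }

block : ∀ k → (ℕ → Bool) → Vec Bool (suc k)
block k a = Vec.tabulate (a ∘ toℕ)

lookup₀-tabulate : ∀ m (a : ℕ → Bool) j → j < m →
                   lookup₀ (Vec.tabulate {n = m} (a ∘ toℕ)) j ≡ a j
lookup₀-tabulate (suc m) a zero    j<       = refl
lookup₀-tabulate (suc m) a (suc j) (s≤s j<) = lookup₀-tabulate m (a ∘ suc) j j<

lookup₀-block : ∀ k a j → j ≤ k → lookup₀ (block k a) j ≡ a j
lookup₀-block k a j j≤k = lookup₀-tabulate (suc k) a j (s≤s j≤k)

mutual
  Sat⇒Ex : ∀ {n} (ks : Vec ℕ n) {h} → Local ks h → Sat ks (curry ks h) → Ex n h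
  Sat⇒Ex []       loc c ρ     = subst T (loc λ ()) c
  Sat⇒Ex (k ∷ ks) loc (x , w) = lookup₀ x , CoSat⇒Al ks (local-tail loc (lookup₀ x)) w

  CoSat⇒Al : ∀ {n} (ks : Vec ℕ n) {h} → Local ks h → CoSat ks (curry ks h) → Al n h
  CoSat⇒Al []       loc c ρ = subst T (loc λ ()) c
  CoSat⇒Al (k ∷ ks) loc w a =
    Ex-≗ _ (local-head loc (lookup₀-block k a))
      (Sat⇒Ex ks (local-tail loc (lookup₀ (block k a))) (w (block k a)))

mutual
  Ex⇒Sat : ∀ {n} (ks : Vec ℕ n) {h} → Local ks h → Ex n h → Sat ks (curry ks h)
  Ex⇒Sat []       loc e       = subst T (loc λ ()) (e λ ())
  Ex⇒Sat (k ∷ ks) loc (a , w) = block k a ,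
    Al⇒CoSat ks (local-tail loc (lookup₀ (block k a)))
      (Al-≗ _ (local-head loc λ j j≤ → sym (lookup₀-block k a j j≤)) w)

  Al⇒CoSat : ∀ {n} (ks : Vec ℕ n) {h} → Local ks h → Al n h → CoSat ks (curry ks h)
  Al⇒CoSat []       loc w   = subst T (loc λ ()) (w λ ())
  Al⇒CoSat (k ∷ ks) loc w x = Ex⇒Sat ks (local-tail loc (lookup₀ x)) (w (lookup₀ x))

mutual
  ¬Sat⇒CoSat : ∀ {n} (ks : Vec ℕ n) {h} →
               ¬ Sat ks (curry ks h) → CoSat ks (curry ks (not ∘ h))
  ¬Sat⇒CoSat []       ¬c   = ¬T⇒T-not _ ¬c
  ¬Sat⇒CoSat (k ∷ ks) ¬s x = ¬CoSat⇒Sat ks (λ w → ¬s (x , w))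

  ¬CoSat⇒Sat : ∀ {n} (ks : Vec ℕ n) {h} →
               ¬ CoSat ks (curry ks h) → Sat ks (curry ks (not ∘ h))
  ¬CoSat⇒Sat []       {h} ¬c = ¬Sat⇒CoSat [] {h} ¬c
  ¬CoSat⇒Sat (k ∷ ks) {h} ¬w
    with anyVec? (λ x → coSat? ks (curry ks λ ρ → not (h (lookup₀ x Vector.∷ ρ))))
  ... | yes s = s
  ... | no ¬s = ⊥-elim (¬w λ x → decidable-stable (sat? ks (curry ks λ ρ → h (lookup₀ x Vector.∷ ρ)))
                  λ ¬s′ → ¬s (x , ¬Sat⇒CoSat ks ¬s′))

-- Determinacy. A search through infinite blocks need not end, so the finite game is decided and the
-- outcome is carried over.
Al-or-Ex : ∀ {n} (ks : Vec ℕ n) {h} → Local ks h → Al n h ⊎ Ex n (not ∘ h)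
Al-or-Ex ks {h} loc with coSat? ks (curry ks h)
... | yes w = inj₁ (CoSat⇒Al ks loc w)
... | no ¬w = inj₂ (Sat⇒Ex ks (cong not ∘ loc) (¬CoSat⇒Sat ks ¬w))

∧≤ˡ : ∀ {j m n} → j ≤ m → j ≤ m ⊔ n
∧≤ˡ j≤ = ≤-trans j≤ (m≤m⊔n _ _)

∧≤ʳ : ∀ {j} m {n} → j ≤ n → j ≤ m ⊔ n
∧≤ʳ m j≤ = ≤-trans j≤ (m≤n⊔m m _)

eval-cong : ∀ {n} (φ : Formula n) {ρ ρ′} →
            (∀ i j → j ≤ maxIndex φ i → ρ i j ≡ ρ′ i j) → eval φ ρ ≡ eval φ ρ′
eval-cong (const b) ρ≡ = refl
eval-cong (var i j) ρ≡ = ρ≡ i j j≤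
  where
  j≤ : j ≤ maxIndex (var i j) i
  j≤ with i ≟ᶠ i
  ... | yes _ = ≤-refl
  ... | no ¬p = ⊥-elim (¬p refl)
eval-cong (neg φ)   ρ≡ = cong not (eval-cong φ ρ≡)
eval-cong (and φ ψ) ρ≡ = cong₂ _∧_
  (eval-cong φ λ i j j≤ → ρ≡ i j (∧≤ˡ j≤))
  (eval-cong ψ λ i j j≤ → ρ≡ i j (∧≤ʳ (maxIndex φ i) j≤))
eval-cong (or φ ψ)  ρ≡ = cong₂ _∨_
  (eval-cong φ λ i j j≤ → ρ≡ i j (∧≤ˡ j≤))
  (eval-cong ψ λ i j j≤ → ρ≡ i j (∧≤ʳ (maxIndex φ i) j≤))

eval-≗ : ∀ {n} (φ : Formula n) {ρ ρ′} → (∀ i j → ρ i j ≡ ρ′ i j) → eval φ ρ ≡ eval φ ρ′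
eval-≗ φ ρ≡ = eval-cong φ λ i j _ → ρ≡ i j

eval-local : ∀ {n} (φ : Formula n) → Local (blocks φ) (eval φ)
eval-local φ ρ≡ = eval-cong φ λ i j j≤ →
  ρ≡ i j (≤-trans j≤ (≤-reflexive (sym (lookup∘tabulate (maxIndex φ) i))))

-- `SAT` and `VAL` in terms of games

FirstMove : ∀ m → (Assignment (suc m) → Bool) → Bool → Set
FirstMove m h y = ∃ λ a → a 0 ≡ y × Al m (λ ρ → h (a Vector.∷ ρ))

SAT-sound : ∀ n x → SAT n x ≡ true → Ex n (eval (formula n x))
SAT-sound n x eq with sat? (blocks (formula n x)) ⟦ formula n x ⟧
... | yes s = Sat⇒Ex (blocks (formula n x)) (eval-local (formula n x)) s

SAT-complete : ∀ n x → Ex n (eval (formula n x)) → SAT n x ≡ true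
SAT-complete n x e with sat? (blocks (formula n x)) ⟦ formula n x ⟧
... | yes _ = refl
... | no ¬s = ⊥-elim (¬s (Ex⇒Sat (blocks (formula n x)) (eval-local (formula n x)) e))

module _ {P : Bool → Set} (P? : Decidable P) where

  ∈-subset⁻ : ∀ (ne : ∃ P) {y} → y ∈ subset P? ne → P y
  ∈-subset⁻ ne y∈ with P? false | P? true
  ∈-subset⁻ _ {false} y∈   | yes p | yes _ = p
  ∈-subset⁻ _ {true}  y∈   | yes _ | yes p = p
  ∈-subset⁻ _         refl | yes p | no _  = p
  ∈-subset⁻ _         refl | no _  | yes p = p
  ∈-subset⁻ (false , p) _  | no ¬p | no _  = ⊥-elim (¬p p)
  ∈-subset⁻ (true  , p) _  | no _  | no ¬p = ⊥-elim (¬p p)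

  ∈-subset⁺ : ∀ (ne : ∃ P) {y} → P y → y ∈ subset P? ne
  ∈-subset⁺ ne p with P? false | P? true
  ∈-subset⁺ _         p   | yes _ | yes _ = tt
  ∈-subset⁺ _ {false} p   | yes _ | no _  = refl
  ∈-subset⁺ _ {true}  p   | yes _ | no ¬p = ⊥-elim (¬p p)
  ∈-subset⁺ _ {false} p   | no ¬p | yes _ = ⊥-elim (¬p p)
  ∈-subset⁺ _ {true}  p   | no _  | yes _ = refl
  ∈-subset⁺ (false , p) _ | no ¬p | no _  = ⊥-elim (¬p p)
  ∈-subset⁺ (true  , p) _ | no _  | no ¬p = ⊥-elim (¬p p)

head-lookup₀ : ∀ {k} (x : Vec Bool (suc k)) → lookup₀ x 0 ≡ Vec.head x
head-lookup₀ (_ ∷ _) = refl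

module _ {m : ℕ} {h : Assignment (suc m) → Bool} where

  val-sound : ∀ ks → Local ks h → ∀ {y} → y ∈ val ks (curry ks h) → Ex (suc m) h → FirstMove m h y
  val-sound (k ∷ ks) loc y∈ e with sat? (k ∷ ks) (curry (k ∷ ks) h)
  ... | no ¬s = ⊥-elim (¬s (Ex⇒Sat (k ∷ ks) loc e))
  ... | yes (x , p)
    with x′ , hd≡ , w ←
      ∈-subset⁻ (firstBit? k ks (curry (k ∷ ks) h)) (Vec.head x , x , refl , p) y∈ =
    lookup₀ x′ , trans (head-lookup₀ x′) hd≡ ,
    CoSat⇒Al ks (local-tail loc (lookup₀ x′)) w

  val-complete : ∀ ks → Local ks h → ∀ {y} → (Ex (suc m) h → FirstMove m h y) → y ∈ val ks (curry ks h)
  val-complete (k ∷ ks) loc win with sat? (k ∷ ks) (curry (k ∷ ks) h)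
  ... | no _ = tt
  ... | yes s@(x , p) with a , a0≡ , w ← win (Sat⇒Ex (k ∷ ks) loc s) =
    ∈-subset⁺ (firstBit? k ks (curry (k ∷ ks) h)) (Vec.head x , x , refl , p)
      (block k a , a0≡ ,
       Al⇒CoSat ks (local-tail loc (lookup₀ (block k a)))
         (Al-≗ m (local-head loc λ j j≤ → sym (lookup₀-block k a j j≤)) w))

VAL-sound : ∀ m x {y} → y ∈ VAL (suc m) x →
  Ex (suc m) (eval (formula (suc m) x)) → FirstMove m (eval (formula (suc m) x)) y
VAL-sound m x = let φ = formula (suc m) x in val-sound (blocks φ) (eval-local φ)

VAL-complete : ∀ m x {y} →
  (Ex (suc m) (eval (formula (suc m) x)) → FirstMove m (eval (formula (suc m) x)) y) →
  y ∈ VAL (suc m) x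
VAL-complete m x = let φ = formula (suc m) x in val-complete (blocks φ) (eval-local φ)

-- Substitution and renaming of blocks

mapVars : ∀ {m n} → (Fin m → ℕ → Formula n) → Formula m → Formula n
mapVars σ (const b) = const b
mapVars σ (var i j) = σ i j
mapVars σ (neg φ)   = neg (mapVars σ φ)
mapVars σ (and φ ψ) = and (mapVars σ φ) (mapVars σ ψ)
mapVars σ (or φ ψ)  = or (mapVars σ φ) (mapVars σ ψ)

eval-mapVars : ∀ {m n} (σ : Fin m → ℕ → Formula n) φ ρ →
  eval (mapVars σ φ) ρ ≡ eval φ λ i j → eval (σ i j) ρ
eval-mapVars σ (const b) ρ = refl
eval-mapVars σ (var i j) ρ = refl
eval-mapVars σ (neg φ)   ρ = cong not (eval-mapVars σ φ ρ)
eval-mapVars σ (and φ ψ) ρ = cong₂ _∧_ (eval-mapVars σ φ ρ) (eval-mapVars σ ψ ρ)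
eval-mapVars σ (or φ ψ)  ρ = cong₂ _∨_ (eval-mapVars σ φ ρ) (eval-mapVars σ ψ ρ)

-- Holds because indices are in unary. It makes the length of the code a sufficient number of rounds
-- for the search.
maxIndex-< : ∀ {n} (φ : Formula n) i → maxIndex φ i < length (encode φ)
maxIndex-< (const b) i = s≤s z≤n
maxIndex-< (var i′ j) i = ≤-trans (s≤s j≥) (s≤s (≤-trans j≤ (n≤1+n _)))
  where
  j≥ : maxIndex (var i′ j) i ≤ j
  j≥ with i ≟ᶠ i′
  ... | yes _ = ≤-refl
  ... | no _  = z≤n
  j≤ : j ≤ length (unary (toℕ i′) ++ unary j)
  j≤ rewrite length-++ (unary (toℕ i′)) {unary j} | length-++ (replicate j true) {false ∷ []}
           | length-replicate j {true} =
    ≤-trans (m≤m+n j 1) (m≤n+m (j + 1) (length (unary (toℕ i′))))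
maxIndex-< (neg φ)   i rewrite length-++ (encode φ) {true ∷ false ∷ []} =
  ≤-trans (maxIndex-< φ i) (m≤m+n _ _)
maxIndex-< (and φ ψ) i
  rewrite length-++ (encode φ) {encode ψ ++ false ∷ true ∷ false ∷ []}
        | length-++ (encode ψ) {false ∷ true ∷ false ∷ []} =
  ⊔-lub (≤-trans (maxIndex-< φ i) (m≤m+n _ _))
    (≤-trans (maxIndex-< ψ i) (≤-trans (m≤m+n _ 3) (m≤n+m _ (length (encode φ)))))
maxIndex-< (or φ ψ) i
  rewrite length-++ (encode φ) {encode ψ ++ false ∷ true ∷ true ∷ []}
        | length-++ (encode ψ) {false ∷ true ∷ true ∷ []} =
  ⊔-lub (≤-trans (maxIndex-< φ i) (m≤m+n _ _))
    (≤-trans (maxIndex-< ψ i) (≤-trans (m≤m+n _ 3) (m≤n+m _ (length (encode φ)))))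

-- Assignments rearranged by a renaming agree only pointwise, so functions of them have to respect
-- pointwise equality.
Ext : ∀ {n} → (Assignment n → Bool) → Set
Ext h = ∀ {ρ ρ′} → (∀ i j → ρ i j ≡ ρ′ i j) → h ρ ≡ h ρ′

ext-tail : ∀ {n} {h : Assignment (suc n) → Bool} → Ext h → ∀ a → Ext (λ ρ → h (a Vector.∷ ρ))
ext-tail ext a ρ≡ = ext λ { zero j → refl ; (suc i) j → ρ≡ i j }

∷-inject₁ : ∀ {n} {h : Assignment (suc n) → Bool} → Ext h → ∀ a (ρ : Assignment (suc n)) →
  h ((a Vector.∷ ρ) ∘ inject₁) ≡ h (a Vector.∷ (ρ ∘ inject₁))
∷-inject₁ ext a ρ = ext λ { zero j → refl ; (suc i) j → refl }

-- A last block on which nothing depends may be dropped.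
mutual
  Ex-inject₁⁻ : ∀ n {h : Assignment n → Bool} → Ext h →
                Ex (suc n) (λ ρ → h (ρ ∘ inject₁)) → Ex n h
  Ex-inject₁⁻ zero    ext (a , w) ρ = subst T (ext λ ()) (w ρ)
  Ex-inject₁⁻ (suc n) ext (a , w) =
    a , Al-inject₁⁻ n (ext-tail ext a) (Al-≗ (suc n) (∷-inject₁ ext a) w)

  Al-inject₁⁻ : ∀ n {h : Assignment n → Bool} → Ext h →
                Al (suc n) (λ ρ → h (ρ ∘ inject₁)) → Al n h
  Al-inject₁⁻ zero    ext w ρ = subst T (ext λ ()) (w (λ _ → false) ρ)
  Al-inject₁⁻ (suc n) ext w a =
    Ex-inject₁⁻ n (ext-tail ext a) (Ex-≗ (suc n) (∷-inject₁ ext a) (w a))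

mutual
  Ex-inject₁⁺ : ∀ n {h : Assignment n → Bool} → Ext h →
                Ex n h → Ex (suc n) (λ ρ → h (ρ ∘ inject₁))
  Ex-inject₁⁺ zero    ext e = (λ _ → false) , λ ρ → e _
  Ex-inject₁⁺ (suc n) ext (a , w) =
    a , Al-≗ (suc n) (sym ∘ ∷-inject₁ ext a) (Al-inject₁⁺ n (ext-tail ext a) w)

  Al-inject₁⁺ : ∀ n {h : Assignment n → Bool} → Ext h →
                Al n h → Al (suc n) (λ ρ → h (ρ ∘ inject₁))
  Al-inject₁⁺ zero    ext w a ρ = w _
  Al-inject₁⁺ (suc n) ext w a =
    Ex-≗ (suc n) (sym ∘ ∷-inject₁ ext a) (Ex-inject₁⁺ n (ext-tail ext a) (w a))

-- Fixing the first bits, and the final query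

prefix : List Bool → (ℕ → Bool) → ℕ → Bool
prefix []      a j       = a j
prefix (b ∷ C) a zero    = b
prefix (b ∷ C) a (suc j) = prefix C a j

prefix-∷ʳ : ∀ C y {a} → a 0 ≡ y → ∀ j → prefix C a j ≡ prefix (C ++ y ∷ []) (a ∘ suc) j
prefix-∷ʳ []      y a0≡ zero    = a0≡
prefix-∷ʳ []      y a0≡ (suc j) = refl
prefix-∷ʳ (b ∷ C) y a0≡ zero    = refl
prefix-∷ʳ (b ∷ C) y a0≡ (suc j) = prefix-∷ʳ C y a0≡ j

prefix-< : ∀ C {a a′} j → j < length C → prefix C a j ≡ prefix C a′ j
prefix-< (b ∷ C) zero    j<       = refl
prefix-< (b ∷ C) (suc j) (s≤s j<) = prefix-< C j j<

module _ {m : ℕ} where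

  fixVar : List Bool → ℕ → Formula (suc m)
  fixVar []      j       = var zero j
  fixVar (b ∷ C) zero    = const b
  fixVar (b ∷ C) (suc j) = fixVar C j

  eval-fixVar : ∀ C j ρ → eval (fixVar C j) ρ ≡ prefix C (ρ zero) j
  eval-fixVar []      j       ρ = refl
  eval-fixVar (b ∷ C) zero    ρ = refl
  eval-fixVar (b ∷ C) (suc j) ρ = eval-fixVar C j ρ

  -- Fixing the first bits of x in f(x, …) to C ...
  fixed-σ : List Bool → Fin (suc m) → ℕ → Formula (suc m)
  fixed-σ C zero    j = fixVar C j
  fixed-σ C (suc i) j = var (suc i) j

  bump : Fin m → ℕ → ℕ
  bump zero    j = suc j
  bump (suc _) j = j

  -- ... and moreover renaming the blocks after x to be those from the first
  -- on, whose first bit is skipped.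
  demoted-σ : List Bool → Fin (suc m) → ℕ → Formula (suc m)
  demoted-σ C zero    j = fixVar C j
  demoted-σ C (suc i) j = var (inject₁ i) (bump i j)

  restrict demote : List Bool → Formula (suc m) → Formula (suc m)
  restrict C = mapVars (fixed-σ C)
  demote   C = mapVars (demoted-σ C)

  -- With first block b y, this says f_C if b = 1, and ¬ f_C(y, …) if b = 0.
  -- Exactly one of the two wins as a game, so the bit b is determined.
  verdict : List Bool → Formula (suc m) → Formula (suc m)
  verdict C φ = or (and (var zero 0) (restrict C φ))
                   (and (neg (var zero 0)) (neg (demote C φ)))

  eval-restrict : ∀ C φ a ρ → eval (restrict C φ) (a Vector.∷ ρ) ≡ eval φ (prefix C a Vector.∷ ρ)
  eval-restrict C φ a ρ = trans (eval-mapVars (fixed-σ C) φ (a Vector.∷ ρ))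
    (eval-≗ φ λ { zero j → eval-fixVar C j (a Vector.∷ ρ) ; (suc i) j → refl })

  restrict-[] : ∀ φ → Ex (suc m) (eval φ) → Ex (suc m) (eval (restrict [] φ))
  restrict-[] φ (a , w) = a , Al-≗ m (λ ρ → sym (eval-restrict [] φ a ρ)) w

  -- The bit 0 of the winning move passes into the fixed bits, and the rest of the move still wins.
  -- Hence whichever allowed bit `VAL` returns, satisfiability is preserved.
  restrict-∷ʳ : ∀ C φ {y} → FirstMove m (eval (restrict C φ)) y →
                Ex (suc m) (eval (restrict (C ++ y ∷ []) φ))
  restrict-∷ʳ C φ {y} (a , a0≡ , w) = a ∘ suc , Al-≗ m
    (λ ρ → trans (eval-restrict C φ a ρ) (trans
      (eval-≗ φ λ { zero j → prefix-∷ʳ C y a0≡ j ; (suc i) j → refl })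
      (sym (eval-restrict (C ++ y ∷ []) φ (a ∘ suc) ρ)))) w

  restrict-sound : ∀ C φ → Ex (suc m) (eval (restrict C φ)) → Ex (suc m) (eval φ)
  restrict-sound C φ (a , w) = prefix C a , Al-≗ m (eval-restrict C φ a) w

demoted : ∀ {m} → Assignment (suc m) → Assignment m
demoted ρ i j = ρ (inject₁ i) (bump i j)

module _ {m : ℕ} (C : List Bool) (φ : Formula (suc m)) where

  -- Once `C` covers the first block, both `restrict` and `demote` compute this function, and the
  -- zeros after `C` are never looked up.
  rest : Assignment m → Bool
  rest ρ = eval φ (prefix C (λ _ → false) Vector.∷ ρ)

  rest-ext : Ext rest
  rest-ext ρ≡ = eval-≗ φ λ { zero j → refl ; (suc i) j → ρ≡ i j }

  rest-local : Local (Vec.tail (blocks φ)) rest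
  rest-local = local-tail (eval-local φ) (prefix C (λ _ → false))

module _ {m : ℕ} (C : List Bool) (φ : Formula (suc m)) (C-long : maxIndex φ zero < length C) where

  restrict≗rest : ∀ a ρ → eval (restrict C φ) (a Vector.∷ ρ) ≡ rest C φ ρ
  restrict≗rest a ρ = trans (eval-restrict C φ a ρ)
    (eval-cong φ λ { zero j j≤ → prefix-< C j (≤-trans (s≤s j≤) C-long) ; (suc i) j _ → refl })

  demote≗rest : ∀ ρ → eval (demote C φ) ρ ≡ rest C φ (demoted ρ)
  demote≗rest ρ = trans (eval-mapVars (demoted-σ C) φ ρ)
    (eval-cong φ λ
      { zero j j≤ → trans (eval-fixVar C j ρ) (prefix-< C j (≤-trans (s≤s j≤) C-long))
      ; (suc i) j _ → refl })

  verdict-true : ∀ {a} → a 0 ≡ true → ∀ ρ → eval (verdict C φ) (a Vector.∷ ρ) ≡ rest C φ ρ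
  verdict-true {a} a0≡ ρ rewrite a0≡ =
    trans (∨-identityʳ _) (restrict≗rest a ρ)

  verdict-false : ∀ {a} → a 0 ≡ false → ∀ ρ →
    eval (verdict C φ) (a Vector.∷ ρ) ≡ not (rest C φ (demoted (a Vector.∷ ρ)))
  verdict-false {a} a0≡ ρ rewrite a0≡ = cong not (demote≗rest (a Vector.∷ ρ))

-- The first block of `h` is what follows bit 0 in `a`, which is chosen existentially. The later
-- blocks of `h` come one place earlier than before, so the last universal block is a dummy and is
-- dropped. For `m = 0` there are no blocks, and both games are the truth value of `h`.
Al-demoted⁻ : ∀ m {h : Assignment m → Bool} → Ext h → ∀ a
  (h′ : Assignment m → Bool) →
  (∀ ρ → h′ ρ ≡ h (demoted (a Vector.∷ ρ))) →
  Al m h′ → Ex m h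
Al-demoted⁻ zero    ext a h′ h′≡ w ρ = subst T (trans (h′≡ ρ) (ext λ ())) (w ρ)
Al-demoted⁻ (suc m) {h} ext a h′ h′≡ w =
  a ∘ suc , Al-inject₁⁻ m (ext-tail ext (a ∘ suc))
    (Al-≗ (suc m) (λ ρ → trans (h′≡ ρ)
      (ext {ρ′ = (a ∘ suc) Vector.∷ (ρ ∘ inject₁)} λ { zero j → refl ; (suc i) j → refl })) w)

Al-demoted⁺ : ∀ m {h : Assignment m → Bool} → Ext h → Ex m h →
  ∃ λ a → a 0 ≡ false × ∀ (h′ : Assignment m → Bool) →
  (∀ ρ → h′ ρ ≡ h (demoted (a Vector.∷ ρ))) → Al m h′
Al-demoted⁺ zero    ext e = (λ _ → false) , refl ,
  λ h′ h′≡ ρ → subst T (trans (ext λ ()) (sym (h′≡ ρ))) (e ρ)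
Al-demoted⁺ (suc m) ext (a , w) =
  (λ { zero → false ; (suc j) → a j }) , refl ,
  λ h′ h′≡ → Al-≗ (suc m)
    (λ ρ → trans
      (ext {ρ = a Vector.∷ (ρ ∘ inject₁)} λ { zero j → refl ; (suc i) j → refl }) (sym (h′≡ ρ)))
    (Al-inject₁⁺ m (ext-tail ext a) w)

module _ {m : ℕ} (C : List Bool) (φ : Formula (suc m)) (C-long : maxIndex φ zero < length C) where

  not-ext : Ext (not ∘ rest C φ)
  not-ext = cong not ∘ rest-ext C φ

  -- By determinacy one of the two claims can be defended, so `VAL` has to return the bit of a
  -- winning move.
  verdict-wins : Ex (suc m) (eval (verdict C φ))
  verdict-wins with Al-or-Ex (Vec.tail (blocks φ)) (rest-local C φ)
  ... | inj₁ w = (λ _ → true) , Al-≗ m (sym ∘ verdict-true C φ C-long {λ _ → true} refl) w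
  ... | inj₂ e with a , a0≡ , w ← Al-demoted⁺ m not-ext e =
    a , w _ (verdict-false C φ C-long {a} a0≡)

  -- A defence of the claim 1 is a winning strategy for f once `C` is put in front; a defence of the
  -- claim 0 beats every strategy for f with `C` fixed. That f itself is then unsatisfiable depends
  -- on how `C` was found, see `Consistent`.
  verdict-decides : ∀ {y} → FirstMove m (eval (verdict C φ)) y →
    (y ≡ true → Ex (suc m) (eval φ)) × (y ≡ false → ¬ Ex (suc m) (eval (restrict C φ)))
  verdict-decides (a , refl , w) =
    (λ a0≡ → restrict-sound C φ (a , Al-≗ m
      (λ ρ → trans (verdict-true C φ C-long {a} a0≡ ρ) (sym (restrict≗rest C φ C-long a ρ))) w)) ,
    (λ { a0≡ (a′ , w′) → Ex-not m
      (Al-demoted⁻ m not-ext a _ (verdict-false C φ C-long {a} a0≡) w)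
      (Al-≗ m (restrict≗rest C φ C-long a′) w′) })

-- If the conjunction is unsatisfiable, then no winning move starts with 1, so the given one starts
-- with 0. If it is satisfiable, one play shows that the move starts with 1.
and-var₀ : ∀ {m} (φ : Formula (suc m)) {y} →
  (y ≡ true → Ex (suc m) (eval (and φ (var zero 0)))) →
  (y ≡ false → ¬ Ex (suc m) (eval (and φ (var zero 0)))) →
  Ex (suc m) (eval φ) → FirstMove m (eval φ) y
and-var₀ {m} φ {true} yes′ no′ e with a , w ← yes′ refl =
  a , T-≡ (proj₂ (T-∧ (proj₂ (Al-play m w)))) , Al-mono m (λ ρ → proj₁ ∘ T-∧) w
  where
  T-∧ : ∀ {x y} → T (x ∧ y) → T x × T y
  T-∧ {true} {true} t = t , t
  T-≡ : ∀ {x} → T x → x ≡ true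
  T-≡ {true} t = refl
and-var₀ {m} φ {false} yes′ no′ (a , w) with a 0 in a0≡
... | false = a , a0≡ , w
... | true  = ⊥-elim (no′ refl (a , Al-≗ m
  (λ ρ → sym (trans (cong (eval φ (a Vector.∷ ρ) ∧_) a0≡) (∧-identityʳ _))) w))

-- Basic programs on six tapes

-- O is the oracle tape, S holds the query to be answered, D a stack height
-- and then the answer, Q a copy of the query, N the number of rounds to go,
-- and C the bits found so far.
pattern O = zero
pattern S = suc zero
pattern D = suc (suc zero)
pattern Q = suc (suc (suc zero))
pattern N = suc (suc (suc (suc zero)))
pattern C = suc (suc (suc (suc (suc zero))))

isBit isOne : ∀ {k} → Fin k → Vec (Maybe Bool) k → Bool
isBit i ms = is-just (Vec.lookup ms i)
isOne i ms = fromMaybe false (Vec.lookup ms i)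

rewind clear forward : ∀ {k} → Fin k → Code k
-- The first step leaves the blank behind the string; the loop ends on the blank before it.
rewind i  = put i keep left ∷ loop (isBit i) (put i keep left ∷ []) ∷ put i keep right ∷ []
clear i   = loop (isBit i) (put i (fixed nothing) right ∷ []) ∷ []
forward i = loop (isBit i) (put i keep right ∷ []) ∷ []

emit : ∀ {k} → List Bool → Code (suc k)
emit = map λ b → put O (fixed (just b)) right

-- This is length w * c + t, but it unfolds along with w.
fuel : ℕ → List Bool → ℕ → ℕ
fuel c w t = foldr (λ _ → c +_) t w

fuel-length : ∀ c w t → fuel c w t ≡ length w * c + t
fuel-length c []      t = refl
fuel-length c (_ ∷ w) t = trans (cong (c +_) (fuel-length c w t)) (sym (+-assoc c (length w * c) t))

fuel-+ : ∀ c w n t → fuel c w (n + t) ≡ n + fuel c w t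
fuel-+ c []      n t = refl
fuel-+ c (_ ∷ w) n t rewrite fuel-+ c w n t =
  trans (sym (+-assoc c n _)) (trans (cong (_+ fuel c w t) (+-comm c n)) (+-assoc n c _))

fuel-ʳ++ : ∀ c w t → fuel c w t ≡ fuel c (w ʳ++ []) t
fuel-ʳ++ c w t = trans (fuel-length c w t)
  (trans (cong (λ l → l * c + t) (sym (trans (length-ʳ++ w) (+-identityʳ _))))
         (sym (fuel-length c (w ʳ++ []) t)))

leadingBits-bits : ∀ {g} w → leadingBits {g} (map bit w) ≡ w
leadingBits-bits []      = refl
leadingBits-bits (b ∷ w) = cong (b ∷_) (leadingBits-bits w)

module _ {g : ℕ} where

  ⟨_∣_⟩ : List Bool → List Bool → HalfTapes g
  ⟨ u ∣ v ⟩ = map bit u , map bit v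

  empty : HalfTapes g
  empty = [] , []

  bits-≔ : ∀ {k} (ts : Vec (HalfTapes g) k) i x →
           Vec.lookup (bits (ts Vec.[ i ]≔ x)) i ≡ toBit (hd (proj₂ x))
  bits-≔ ts i x = trans (lookup-map i _ (ts Vec.[ i ]≔ x))
                        (cong (toBit ∘ hd ∘ proj₂) (lookup∘updateAt i ts))

  module _ {k : ℕ} {φ : PromiseProblem} {P : Vec (HalfTapes g) (suc k) → Set} where

    enter-≔ : ∀ {t κ p} ts i {ls b rs} →
      Ev φ P t (p ++ loop (isBit i) p ∷ κ) (ts Vec.[ i ]≔ (ls , bit b ∷ rs)) →
      Ev φ P (suc t) (loop (isBit i) p ∷ κ) (ts Vec.[ i ]≔ (ls , bit b ∷ rs))
    enter-≔ ts i = enter (cong is-just (bits-≔ ts i _))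

    leave-≔ : ∀ {t κ p} ts i {ls rs} → toBit (hd rs) ≡ nothing →
      Ev φ P t κ (ts Vec.[ i ]≔ (ls , rs)) →
      Ev φ P (suc t) (loop (isBit i) p ∷ κ) (ts Vec.[ i ]≔ (ls , rs))
    leave-≔ ts i rs≡ = leave (trans (cong is-just (bits-≔ ts i _)) (cong is-just rs≡))

    keep-≔ : ∀ {t κ d x} ts i → Ev φ P t κ (ts Vec.[ i ]≔ go d x) →
             Ev φ P (suc t) (put i keep d ∷ κ) (ts Vec.[ i ]≔ x)
    keep-≔ {t} {κ} ts i e = put (subst (Ev φ P t κ) (sym (updateAt-updateAt i ts)) e)

    fixed-≔ : ∀ {t κ m d x} ts i → Ev φ P t κ (ts Vec.[ i ]≔ overwrite (fromBit m) d x) →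
              Ev φ P (suc t) (put i (fixed m) d ∷ κ) (ts Vec.[ i ]≔ x)
    fixed-≔ {t} {κ} ts i e = put (subst (Ev φ P t κ) (sym (updateAt-updateAt i ts)) e)

    toBit-blank : ∀ (ss : List (Sym g)) → toBit (hd (blank ∷ᵇ ss)) ≡ nothing
    toBit-blank ss = cong toBit (hd-∷ᵇ blank ss)

    rewind-loop : ∀ ts i u v {t κ} →
      Ev φ P t κ (ts Vec.[ i ]≔ ([] , blank ∷ᵇ map bit (u ʳ++ v))) →
      Ev φ P (fuel 2 u (suc t)) (loop (isBit i) (put i keep left ∷ []) ∷ κ)
         (ts Vec.[ i ]≔ go left ⟨ u ∣ v ⟩)
    rewind-loop ts i []      v e = leave-≔ ts i (toBit-blank (map bit v)) e
    rewind-loop ts i (b ∷ u) v e = enter-≔ ts i (keep-≔ ts i (rewind-loop ts i u (b ∷ v) e))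

    rewinds : ∀ ts i u v {t κ} → Ev φ P t κ (ts Vec.[ i ]≔ ⟨ [] ∣ u ʳ++ v ⟩) →
      Ev φ P (fuel 2 u (3 + t)) (rewind i ++ κ) (ts Vec.[ i ]≔ ⟨ u ∣ v ⟩)
    rewinds ts i u v {t} {κ} e rewrite fuel-+ 2 u 1 (2 + t) =
      keep-≔ ts i (rewind-loop ts i u v (keep-≔ ts i
        (subst (λ x → Ev φ P t κ (ts Vec.[ i ]≔ x))
          (sym (cong₂ _,_ (cong (_∷ᵇ []) (hd-∷ᵇ blank (map bit (u ʳ++ v))))
                          (tl-∷ᵇ blank (map bit (u ʳ++ v))))) e)))

    clears : ∀ ts i v {t κ} → Ev φ P t κ (ts Vec.[ i ]≔ empty) →
      Ev φ P (fuel 2 v (suc t)) (clear i ++ κ) (ts Vec.[ i ]≔ ⟨ [] ∣ v ⟩)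
    clears ts i []      e = leave-≔ ts i refl e
    clears ts i (b ∷ v) e = enter-≔ ts i (fixed-≔ ts i (clears ts i v e))

    forwards : ∀ ts i u v {t κ} → Ev φ P t κ (ts Vec.[ i ]≔ ⟨ v ʳ++ u ∣ [] ⟩) →
      Ev φ P (fuel 2 v (suc t)) (forward i ++ κ) (ts Vec.[ i ]≔ ⟨ u ∣ v ⟩)
    forwards ts i u []      e = leave-≔ ts i refl e
    forwards ts i u (b ∷ v) e = enter-≔ ts i (keep-≔ ts i (forwards ts i (b ∷ u) v e))

    emits : ∀ w u {t κ} {ts : Vec (HalfTapes g) k} →
      Ev φ P t κ (⟨ w ʳ++ u ∣ [] ⟩ ∷ ts) →
      Ev φ P (length w + t) (emit w ++ κ) (⟨ u ∣ [] ⟩ ∷ ts)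
    emits []      u e = e
    emits (b ∷ w) u e = put (emits w (b ∷ u) e)

-- Tape S may hold bits before the query, so no blank marks where the way back ends. The copy on Q
-- is enclosed in blanks and counts the steps.
fetch : Code 6
fetch = loop (isBit S) (put Q (copy S) right ∷ put S keep right ∷ []) ∷
        put Q keep left ∷ loop (isBit Q) (put Q keep left ∷ put S keep left ∷ []) ∷
        put Q keep right ∷ []

copyBit copyUnary : Code 6
copyBit   = put O (copy Q) right ∷ put Q keep right ∷ []
copyUnary = loop (isOne Q) copyBit ∷ copyBit

skipBit : Code 6
skipBit = put Q keep right ∷ []

module _ {g : ℕ} {φ : PromiseProblem} {P : Vec (HalfTapes g) 6 → Set} where

  fetch-forth : ∀ {t κ o d n c} ls q rest u → toBit (hd rest) ≡ nothing →
    Ev φ P t κ (o ∷ (map bit q ʳ++ ls , rest) ∷ d ∷ ⟨ q ʳ++ u ∣ [] ⟩ ∷ n ∷ c ∷ []) →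
    Ev φ P (fuel 3 q (suc t))
       (loop (isBit S) (put Q (copy S) right ∷ put S keep right ∷ []) ∷ κ)
       (o ∷ (ls , map bit q ++ rest) ∷ d ∷ ⟨ u ∣ [] ⟩ ∷ n ∷ c ∷ [])
  fetch-forth ls []      rest u rest≡ e = leave (cong is-just rest≡) e
  fetch-forth ls (b ∷ q) rest u rest≡ e =
    enter refl (put (put (fetch-forth (bit b ∷ ls) q rest (b ∷ u) rest≡ e)))

  fetch-back : ∀ {t κ o d n c} ls u rs v →
    Ev φ P t κ (o ∷ (ls , map bit u ʳ++ rs) ∷ d ∷
                ([] , blank ∷ᵇ map bit (u ʳ++ v)) ∷ n ∷ c ∷ []) →
    Ev φ P (fuel 3 u (suc t))
       (loop (isBit Q) (put Q keep left ∷ put S keep left ∷ []) ∷ κ)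
       (o ∷ (map bit u ++ ls , rs) ∷ d ∷ go left ⟨ u ∣ v ⟩ ∷ n ∷ c ∷ [])
  fetch-back ls []      rs v e = leave (cong is-just (cong toBit (hd-∷ᵇ blank (map bit v)))) e
  fetch-back ls (b ∷ u) rs v e = enter refl (put (put (fetch-back ls u (bit b ∷ rs) (b ∷ v) e)))

  split-bits : ∀ (rs : List (Sym g)) → ∃ λ rest →
    rs ≡ map bit (leadingBits rs) ++ rest × toBit (hd rest) ≡ nothing
  split-bits []           = [] , refl , refl
  split-bits (blank ∷ rs) = blank ∷ rs , refl , refl
  split-bits (aux a ∷ rs) = aux a ∷ rs , refl , refl
  split-bits (bit b ∷ rs) with rest , rs≡ , rest≡ ← split-bits rs =
    rest , cong (bit b ∷_) rs≡ , rest≡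

  fetches : ∀ {t κ o d n c} ls rs →
    Ev φ P t κ (o ∷ (ls , rs) ∷ d ∷ ⟨ [] ∣ leadingBits rs ⟩ ∷ n ∷ c ∷ []) →
    Ev φ P (fuel 6 (leadingBits rs) (4 + t)) (fetch ++ κ)
       (o ∷ (ls , rs) ∷ d ∷ empty ∷ n ∷ c ∷ [])
  fetches {t} {κ} {o} {d} {n} {c} ls rs e with leadingBits rs | split-bits rs
  ... | q | rest , refl , rest≡ =
    weaken time≤ (fetch-forth ls q rest [] rest≡ (put
      (subst (λ l → Ev φ P (fuel 3 (q ʳ++ []) (2 + t)) _
                       (o ∷ (l , rest) ∷ d ∷ go left ⟨ q ʳ++ [] ∣ [] ⟩ ∷ n ∷ c ∷ []))
         left≡
         (fetch-back ls (q ʳ++ []) rest [] (put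
           (subst (Ev φ P t κ)
             (cong₂ (λ r x → o ∷ (ls , r) ∷ d ∷ x ∷ n ∷ c ∷ []) right≡ home) e))))))
    where
    left≡ : map bit (q ʳ++ []) ++ ls ≡ map bit q ʳ++ ls
    left≡ = trans (cong (_++ ls) (map-ʳ++ bit q))
                  (sym (trans (ʳ++-defn (map bit q))
                    (cong (_++ ls) (sym (trans (ʳ++-defn (map bit q)) (++-identityʳ _))))))

    right≡ : map bit q ++ rest ≡ map bit (q ʳ++ []) ʳ++ rest
    right≡ = sym (trans (cong (_ʳ++ rest) (map-ʳ++ bit q)) (ʳ++-ʳ++ (map bit q)))

    back≡ : (q ʳ++ []) ʳ++ [] ≡ q
    back≡ = trans (ʳ++-ʳ++ q) (++-identityʳ q)

    home : ⟨ [] ∣ q ⟩ ≡ go right ([] , blank ∷ᵇ map bit ((q ʳ++ []) ʳ++ []))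
    home = sym (cong₂ _,_ (cong (_∷ᵇ []) (hd-∷ᵇ blank (map bit ((q ʳ++ []) ʳ++ []))))
      (trans (tl-∷ᵇ blank (map bit ((q ʳ++ []) ʳ++ []))) (cong (map bit) back≡)))

    time≤ : fuel 3 q (suc (suc (fuel 3 (q ʳ++ []) (2 + t)))) ≤ fuel 6 q (4 + t)
    time≤ = ≤-reflexive (trans (cong (λ l → fuel 3 q (2 + l)) (sym (fuel-ʳ++ 3 q (2 + t))))
              (trans (cong (fuel 3 q) (sym (fuel-+ 3 q 2 (2 + t)))) (double q)))
      where
      double : ∀ q → fuel 3 q (fuel 3 q (4 + t)) ≡ fuel 6 q (4 + t)
      double []      = refl
      double (_ ∷ q) rewrite fuel-+ 3 q 3 (fuel 3 q (4 + t)) = cong (6 +_) (double q)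

  -- Three steps per bit are made. Waiting raises this to 8, the rate of `Rewrites`, which also
  -- covers the parsing of tokens.
  copiesUnary : ∀ {t κ s d n c} j u o w →
    Ev φ P t κ (⟨ unary j ʳ++ o ∣ [] ⟩ ∷ s ∷ d ∷ ⟨ unary j ʳ++ u ∣ w ⟩ ∷ n ∷ c ∷ []) →
    Ev φ P (fuel 8 (unary j) t) (copyUnary ++ κ)
       (⟨ o ∣ [] ⟩ ∷ s ∷ d ∷ ⟨ u ∣ unary j ++ w ⟩ ∷ n ∷ c ∷ [])
  copiesUnary zero    u o w e = waits 5 (leave refl (put (put e)))
  copiesUnary (suc j) u o w e =
    waits 5 (enter refl (put (put (copiesUnary j (true ∷ u) (true ∷ o) w e))))

-- Rewriting codes of formulas

fixBit : Code 6
fixBit =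
  -- The unary index is read in step with C. If it ends while C still shows a bit, this is the value
  -- of the variable; otherwise what is left of the index is the new index.
  loop (λ ms → isBit C ms ∧ isOne Q ms) (put Q keep right ∷ put C keep right ∷ []) ∷
  switch C (λ { (just _) → put Q keep right ∷ emit (false ∷ false ∷ []) ++ put O (copy C) right ∷ []
              ; nothing  → emit (true ∷ true ∷ false ∷ []) ++ copyUnary }) ∷
  rewind C

-- Copies a formula from tape Q to the oracle tape, fixing the first bits of
-- block 0 to those on tape C, and leaving the other blocks to p.
transduce : Code 6 → Code 6
transduce p = loop (isBit Q) (switch Q (λ
  { (just false) → copyBit ++ copyBit ++ copyBit
  ; _ → put Q keep right ∷ switch Q (λ
    { (just false) → emit (true ∷ []) ++ copyBit
    ; _ → put Q keep right ∷ switch Q (λ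
      { (just false) → put Q keep right ∷ fixBit
      ; _ → p }) ∷ [] }) ∷ [] }) ∷ []) ∷ []

-- Both start on the first 1 of the block index. `demoteVar` drops this 1. If a 0 follows, block 1
-- becomes block 0, and an extra 1 is put in front of the variable index to skip the bit b.
copyVar demoteVar : Code 6
copyVar   = emit (true ∷ true ∷ []) ++ copyBit ++ copyUnary ++ copyUnary
demoteVar = put Q keep right ∷ emit (true ∷ true ∷ []) ++
  switch Q (λ { (just false) → emit (false ∷ true ∷ []) ++ put Q keep right ∷ []
              ; _ → copyUnary }) ∷ copyUnary

module _ {g : ℕ} {φ : PromiseProblem} {P : Vec (HalfTapes g) 6 → Set} where

  fixesBit : ∀ {m t κ s d n} (C₁ C₂ : List Bool) j u o w →
    Ev φ P t κ (⟨ encode (fixVar {m} C₂ j) ʳ++ o ∣ [] ⟩ ∷ s ∷ d ∷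
                ⟨ unary j ʳ++ u ∣ w ⟩ ∷ n ∷ ⟨ [] ∣ C₁ ʳ++ C₂ ⟩ ∷ []) →
    Ev φ P (5 + fuel 8 (unary j) (fuel 2 C₁ (3 + t))) (fixBit ++ κ)
       (⟨ o ∣ [] ⟩ ∷ s ∷ d ∷ ⟨ u ∣ unary j ++ w ⟩ ∷ n ∷ ⟨ C₁ ∣ C₂ ⟩ ∷ [])
  fixesBit C₁ [] j u o w e =
    leave refl (switch (put (put (put (copiesUnary j u (false ∷ true ∷ true ∷ o) w
      (rewinds (_ ∷ _ ∷ _ ∷ _ ∷ _ ∷ empty ∷ []) C C₁ [] e))))))
  fixesBit C₁ (b ∷ C₂) zero u o w e =
    waits 7 (leave refl (switch (put (put (put (put
      (rewinds (_ ∷ _ ∷ _ ∷ _ ∷ _ ∷ empty ∷ []) C C₁ (b ∷ C₂) e)))))))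
  fixesBit {t = t} C₁ (b ∷ C₂) (suc j) u o w e =
    waits 3 (enter refl (put (put (weaken time≤ (fixesBit (b ∷ C₁) C₂ j (true ∷ u) o w e)))))
    where
    time≤ : 5 + fuel 8 (unary j) (2 + fuel 2 C₁ (3 + t)) ≤
            7 + fuel 8 (unary j) (fuel 2 C₁ (3 + t))
    time≤ = ≤-reflexive (cong (5 +_) (fuel-+ 8 (unary j) 2 (fuel 2 C₁ (3 + t))))

  -- The loop is ahead again after each piece, so rewritings of adjacent pieces compose. In postfix
  -- notation a substitution replaces token by token, without a stack.
  Rewrites : List Bool → Code 6 → List Bool → List Bool → Set
  Rewrites Cs p w w′ = ∀ {t κ s d n} u o v →
    Ev φ P t (transduce p ++ κ)
       (⟨ w′ ʳ++ o ∣ [] ⟩ ∷ s ∷ d ∷ ⟨ w ʳ++ u ∣ v ⟩ ∷ n ∷ ⟨ [] ∣ Cs ⟩ ∷ []) →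
    Ev φ P (fuel 8 w t) (transduce p ++ κ)
       (⟨ o ∣ [] ⟩ ∷ s ∷ d ∷ ⟨ u ∣ w ++ v ⟩ ∷ n ∷ ⟨ [] ∣ Cs ⟩ ∷ [])

  module _ {Cs : List Bool} {p : Code 6} where

    rewrites-++ : ∀ w₁ w₁′ {w₂ w₂′} → Rewrites Cs p w₁ w₁′ → Rewrites Cs p w₂ w₂′ →
                  Rewrites Cs p (w₁ ++ w₂) (w₁′ ++ w₂′)
    rewrites-++ w₁ w₁′ {w₂} {w₂′} r₁ r₂ {t} u o v e
      rewrite ++-assoc w₁ w₂ v | foldr-++ (λ _ → 8 +_) t w₁ w₂
            | ++-ʳ++ w₁ {w₂} {u} | ++-ʳ++ w₁′ {w₂′} {o} =
      r₁ u o (w₂ ++ v) (r₂ (w₁ ʳ++ u) (w₁′ ʳ++ o) v e)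

    rewrites-triple : ∀ b b′ → Rewrites Cs p (false ∷ b ∷ b′ ∷ []) (false ∷ b ∷ b′ ∷ [])
    rewrites-triple b b′ u o v e =
      waits 16 (enter refl (switch (put (put (put (put (put (put e))))))))

    rewrites-neg : Rewrites Cs p (true ∷ false ∷ []) (true ∷ false ∷ [])
    rewrites-neg u o v e =
      waits 9 (enter refl (switch (put (switch (put (put (put e)))))))

    rewrites-fixed : ∀ {m} j →
      Rewrites Cs p (encode (var {suc m} zero j)) (encode (fixVar {m} Cs j))
    rewrites-fixed {m} j {t} u o v e =
      waits 9 (enter refl (switch (put (switch (put (switch (put
        (weaken time≤ (fixesBit {m} [] Cs j (false ∷ true ∷ true ∷ u) o v e)))))))))
      where
      time≤ : 5 + fuel 8 (unary j) (3 + t) ≤ 8 + fuel 8 (unary j) t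
      time≤ = ≤-reflexive (cong (5 +_) (fuel-+ 8 (unary j) 3 t))

    module _ {m : ℕ} (σ : Fin (suc m) → ℕ → Formula (suc m))
             (fixed : ∀ j → σ zero j ≡ fixVar Cs j)
             (others : ∀ i j → Rewrites Cs p (encode (var (suc i) j)) (encode (σ (suc i) j)))
             where

      rewrites : ∀ ψ → Rewrites Cs p (encode ψ) (encode (mapVars σ ψ))
      rewrites (const b) = rewrites-triple false b
      rewrites (var zero j) rewrite fixed j = rewrites-fixed j
      rewrites (var (suc i) j) = others i j
      rewrites (neg ψ)   = rewrites-++ (encode ψ) (encode (mapVars σ ψ)) (rewrites ψ) rewrites-neg
      rewrites (and ψ χ) = rewrites-++ (encode ψ) (encode (mapVars σ ψ)) (rewrites ψ)
        (rewrites-++ (encode χ) (encode (mapVars σ χ)) (rewrites χ) (rewrites-triple true false))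
      rewrites (or ψ χ)  = rewrites-++ (encode ψ) (encode (mapVars σ ψ)) (rewrites ψ)
        (rewrites-++ (encode χ) (encode (mapVars σ χ)) (rewrites χ) (rewrites-triple true true))

      transduces : ∀ ψ {t κ s d n} o →
        Ev φ P t κ (⟨ encode (mapVars σ ψ) ʳ++ o ∣ [] ⟩ ∷ s ∷ d ∷
                    ⟨ encode ψ ʳ++ [] ∣ [] ⟩ ∷ n ∷ ⟨ [] ∣ Cs ⟩ ∷ []) →
        Ev φ P (fuel 8 (encode ψ) (suc t)) (transduce p ++ κ)
           (⟨ o ∣ [] ⟩ ∷ s ∷ d ∷ ⟨ [] ∣ encode ψ ⟩ ∷ n ∷ ⟨ [] ∣ Cs ⟩ ∷ [])
      transduces ψ {t} {κ} {s} {d} {n} o e =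
        subst (λ w → Ev φ P (fuel 8 (encode ψ) (suc t)) (transduce p ++ κ)
                (⟨ o ∣ [] ⟩ ∷ s ∷ d ∷ ⟨ [] ∣ w ⟩ ∷ n ∷ ⟨ [] ∣ Cs ⟩ ∷ []))
          (++-identityʳ (encode ψ))
          (rewrites ψ [] o [] (leave refl e))

  rewrites-copied : ∀ {m Cs} i j →
    Rewrites Cs copyVar (encode (var {suc m} (suc i) j)) (encode (var {suc m} (suc i) j))
  rewrites-copied i j {t} u o v e
    rewrite ++-assoc (unary (toℕ i)) (unary j) v
          | foldr-++ (λ _ → 8 +_) t (unary (toℕ i)) (unary j)
          | ++-ʳ++ (unary (toℕ i)) {unary j} {true ∷ true ∷ true ∷ u}
          | ++-ʳ++ (unary (toℕ i)) {unary j} {true ∷ true ∷ true ∷ o} =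
    waits 14 (enter refl (switch (put (switch (put (switch (put (put (put (put
      (copiesUnary (toℕ i) _ _ (unary j ++ v) (copiesUnary j _ _ v e))))))))))))

  rewrites-demoted : ∀ {m Cs} i j →
    Rewrites Cs demoteVar (encode (var {suc m} (suc i) j))
                          (encode (var {suc m} (inject₁ i) (bump i j)))
  rewrites-demoted zero j u o v e =
    waits 19 (enter refl (switch (put (switch (put (switch (put (put (put (switch (put (put (put
      (copiesUnary j _ _ v e))))))))))))))
  rewrites-demoted (suc i) j {t} u o v e
    rewrite toℕ-inject₁ i
          | ++-assoc (unary (toℕ i)) (unary j) v
          | foldr-++ (λ _ → 8 +_) t (unary (toℕ i)) (unary j)
          | ++-ʳ++ (unary (toℕ i)) {unary j} {true ∷ true ∷ true ∷ true ∷ u}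
          | ++-ʳ++ (unary (toℕ i)) {unary j} {true ∷ true ∷ true ∷ o} =
    waits 14 (enter refl (switch (put (switch (put (switch (put (put (put (switch
      (copiesUnary (suc (toℕ i)) _ _ (unary j ++ v) (copiesUnary j _ _ v e))))))))))))

-- Recognising codes of formulas

push fail : Code 6
push = put D (fixed (just true)) right ∷ []
-- Going to the end of Q makes the loop of `check` stop; two pushes suffice whatever the height was.
fail = forward Q ++ push ++ push

checkIndex : Code 6
checkIndex = loop (isOne Q) skipBit ∷
  switch Q (λ { nothing → fail ; _ → put Q keep right ∷ push }) ∷ []

checkBlock : ℕ → Code 6
checkBlock zero    = fail
checkBlock (suc k) = switch Q (λ
  { (just false) → put Q keep right ∷ checkIndex
  ; (just true)  → put Q keep right ∷ checkBlock k
  ; nothing      → fail }) ∷ []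

checkUnary checkBinary : Code 6
checkUnary  = put D keep left ∷ switch D (λ
  { (just _) → put D keep right ∷ []
  ; nothing  → fail }) ∷ []
checkBinary = put D keep left ∷ switch D (λ
  { (just _) → put D (fixed nothing) left ∷ switch D (λ
    { (just _) → put D keep right ∷ []
    ; nothing  → fail }) ∷ []
  ; nothing  → fail }) ∷ []

-- Follows `decode`, with the height of the stack in unary on tape D.  On
-- failure a height of at least 2 is left.
check : ℕ → Code 6
check n = loop (isBit Q) (switch Q (λ
  { (just false) → put Q keep right ∷ switch Q (λ
    { (just false) → put Q keep right ∷
        switch Q (λ { nothing → fail ; _ → put Q keep right ∷ push }) ∷ []
    ; (just true) → put Q keep right ∷
        switch Q (λ { nothing → fail ; _ → put Q keep right ∷ checkBinary }) ∷ []
    ; nothing → fail }) ∷ []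
  ; _ → put Q keep right ∷ switch Q (λ
    { (just false) → put Q keep right ∷ checkUnary
    ; (just true)  → put Q keep right ∷ checkBlock n
    ; nothing      → fail }) ∷ [] }) ∷ []) ∷ []

-- The final height alone tells whether `decode` succeeded: it is 1 exactly then.
data Verdict {A : Set} : Maybe A → ℕ → Set where
  valid     : ∀ {x} → Verdict (just x) 1
  underflow : Verdict nothing 0
  failed    : ∀ {d} → Verdict nothing (2 + d)

module _ {g : ℕ} {φ : PromiseProblem} {P : Vec (HalfTapes g) 6 → Set}
         {n t : ℕ} {κ : Code 6} {o s n′ c : HalfTapes g} where

  ones : ℕ → List Bool
  ones d = replicate d true

  state : ℕ → List Bool → List Bool → Vec (HalfTapes g) 6
  state d u w = o ∷ s ∷ ⟨ ones d ∣ [] ⟩ ∷ ⟨ u ∣ w ⟩ ∷ n′ ∷ c ∷ []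

  fails : ∀ {d} u w → Ev φ P t κ (state (2 + d) (w ʳ++ u) []) →
          Ev φ P (fuel 8 w (4 + t)) (fail ++ check n ++ κ) (state d u w)
  fails u []      e = leave refl (put (put (leave refl e)))
  fails u (b ∷ w) e = waits 6 (enter refl (put (fails (b ∷ u) w e)))

  drop-≤ : ∀ {a l} k {N} → a + (k + l) ≤ N → a + l ≤ N
  drop-≤ {a} {l} k = ≤-trans (+-monoʳ-≤ a (m≤n+m l k))

  push-≤ : ∀ {a l} k {N} → a + (suc k + l) ≤ N → suc a + l ≤ N
  push-≤ {a} {l} k p = drop-≤ {suc a} k (≤-trans (≤-reflexive (sym (+-suc a (k + l)))) p)

  module _ {N : ℕ} where

    -- The bound on `d` limits the time for blanking tape D afterwards. No token is shorter than
    -- what it pushes, and a failure adds at most 2.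
    Continue : Maybe (Formula n) → List Bool → List Bool → Set
    Continue m u w = ∀ {d} → Verdict m d → d ≤ 2 + N → Ev φ P t κ (state d (w ʳ++ u) [])

    failing : ∀ {m : Maybe (Formula n)} {d l} u w → m ≡ nothing → d + l ≤ N → Continue m u w →
      Ev φ P (fuel 8 w (4 + t)) (fail ++ check n ++ κ) (state d u w)
    failing u w refl p h = fails u w (h failed (s≤s (s≤s (≤-trans (m≤m+n _ _) p))))

    failing⁺ : ∀ {m : Maybe (Formula n)} {d l} u w → m ≡ nothing → d + l ≤ N → Continue m u w →
      Ev φ P (fuel 8 w (6 + t)) (fail ++ check n ++ κ) (state d u w)
    failing⁺ u w m≡ p h = weaken
      (≤-trans (m≤n+m _ 2) (≤-reflexive (sym (fuel-+ 8 w 2 (4 + t))))) (failing u w m≡ p h)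

    mutual
      checks : ∀ st u w → length st + length w ≤ N → Continue (decode st w) u w →
        Ev φ P (fuel 8 w (6 + t)) (check n ++ κ) (state (length st) u w)
      checks [] u [] p h = waits 5 (leave refl (h underflow z≤n))
      checks (ψ ∷ []) u [] p h = waits 5 (leave refl (h valid (s≤s z≤n)))
      checks (ψ ∷ χ ∷ st) u [] p h =
        waits 5 (leave refl (h failed (≤-trans (m≤m+n _ 0) (≤-trans p (m≤n+m N 2)))))
      checks st u (false ∷ []) p h =
        waits 6 (enter refl (switch (put (switch (failing {l = 0} (false ∷ u) [] (truncated st) (drop-≤ 1 p) h)))))
        where
        truncated : ∀ (st : List (Formula n)) → decode st (false ∷ []) ≡ nothing
        truncated []          = refl
        truncated (_ ∷ [])    = refl
        truncated (_ ∷ _ ∷ _) = refl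
      checks st u (false ∷ false ∷ []) p h =
        waits 12 (enter refl (switch (put (switch (put (switch
          (failing {l = 0} (false ∷ false ∷ u) [] (truncated st) (drop-≤ 2 p) h)))))))
        where
        truncated : ∀ (st : List (Formula n)) → decode st (false ∷ false ∷ []) ≡ nothing
        truncated []          = refl
        truncated (_ ∷ [])    = refl
        truncated (_ ∷ _ ∷ _) = refl
      checks st u (false ∷ true ∷ []) p h =
        waits 12 (enter refl (switch (put (switch (put (switch
          (failing {l = 0} (true ∷ false ∷ u) [] (truncated st) (drop-≤ 2 p) h)))))))
        where
        truncated : ∀ (st : List (Formula n)) → decode st (false ∷ true ∷ []) ≡ nothing
        truncated []          = refl
        truncated (_ ∷ [])    = refl
        truncated (_ ∷ _ ∷ _) = refl
      checks st u (true ∷ []) p h =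
        waits 6 (enter refl (switch (put (switch (failing {l = 0} (true ∷ u) [] (truncated st) (drop-≤ 1 p) h)))))
        where
        truncated : ∀ (st : List (Formula n)) → decode st (true ∷ []) ≡ nothing
        truncated []          = refl
        truncated (_ ∷ [])    = refl
        truncated (_ ∷ _ ∷ _) = refl
      checks st u (false ∷ false ∷ false ∷ w) p h =
        waits 16 (enter refl (switch (put (switch (put (switch (put (put
          (checks (const false ∷ st) (false ∷ false ∷ false ∷ u) w (push-≤ {length st} 2 p) h)))))))))
      checks st u (false ∷ false ∷ true ∷ w) p h =
        waits 16 (enter refl (switch (put (switch (put (switch (put (put
          (checks (const true ∷ st) (true ∷ false ∷ false ∷ u) w (push-≤ {length st} 2 p) h)))))))))
      checks [] u (false ∷ true ∷ false ∷ w) p h =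
        waits 15 (enter refl (switch (put (switch (put (switch (put (put (switch
          (failing⁺ (false ∷ true ∷ false ∷ u) w refl (drop-≤ {0} 3 p) h))))))))))
      checks [] u (false ∷ true ∷ true ∷ w) p h =
        waits 15 (enter refl (switch (put (switch (put (switch (put (put (switch
          (failing⁺ (true ∷ true ∷ false ∷ u) w refl (drop-≤ {0} 3 p) h))))))))))
      checks (ψ ∷ []) u (false ∷ true ∷ false ∷ w) p h =
        waits 13 (enter refl (switch (put (switch (put (switch (put (put (switch (put (switch
          (failing⁺ (false ∷ true ∷ false ∷ u) w refl (drop-≤ {0} 4 p) h))))))))))))
      checks (ψ ∷ []) u (false ∷ true ∷ true ∷ w) p h =
        waits 13 (enter refl (switch (put (switch (put (switch (put (put (switch (put (switch
          (failing⁺ (true ∷ true ∷ false ∷ u) w refl (drop-≤ {0} 4 p) h))))))))))))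
      checks (ψ ∷ χ ∷ st) u (false ∷ true ∷ false ∷ w) p h =
        waits 12 (enter refl (switch (put (switch (put (switch (put (put (switch (put (switch (put
          (checks (and χ ψ ∷ st) (false ∷ true ∷ false ∷ u) w
            (drop-≤ {suc (length st)} 3 (≤-trans (n≤1+n _) p)) h)))))))))))))
      checks (ψ ∷ χ ∷ st) u (false ∷ true ∷ true ∷ w) p h =
        waits 12 (enter refl (switch (put (switch (put (switch (put (put (switch (put (switch (put
          (checks (or χ ψ ∷ st) (true ∷ true ∷ false ∷ u) w
            (drop-≤ {suc (length st)} 3 (≤-trans (n≤1+n _) p)) h)))))))))))))
      checks [] u (true ∷ false ∷ w) p h =
        waits 9 (enter refl (switch (put (switch (put (put (switch
          (failing⁺ (false ∷ true ∷ u) w refl (drop-≤ {0} 2 p) h))))))))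
      checks (ψ ∷ st) u (true ∷ false ∷ w) p h =
        waits 8 (enter refl (switch (put (switch (put (put (switch (put
          (checks (neg ψ ∷ st) (false ∷ true ∷ u) w (drop-≤ {suc (length st)} 2 p) h)))))))))
      checks st u (true ∷ true ∷ w) p h =
        waits 11 (enter refl (switch (put (switch (put
          (checkBlocks st n id (true ∷ true ∷ u) w (drop-≤ 2 p) h))))))

      checkBlocks : ∀ st k (ι : Fin k → Fin n) u w → length st + length w ≤ N →
        Continue (decodeBlock st k ι w) u w →
        Ev φ P (fuel 8 w (6 + t)) (checkBlock k ++ check n ++ κ) (state (length st) u w)
      checkBlocks st zero ι u w p h = failing⁺ u w refl p h
      checkBlocks st (suc k) ι u [] p h =
        wait (switch (failing u [] refl p h))
      checkBlocks st (suc k) ι u (false ∷ w) p h =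
        waits 6 (switch (put (checkIndices st (ι zero) 0 (false ∷ u) w (drop-≤ 1 p) h)))
      checkBlocks st (suc k) ι u (true ∷ w) p h =
        waits 6 (switch (put (checkBlocks st k (ι ∘ suc) (true ∷ u) w (drop-≤ 1 p) h)))

      checkIndices : ∀ st (i : Fin n) j u w → length st + length w ≤ N →
        Continue (decodeIndex st i j w) u w →
        Ev φ P (fuel 8 w (6 + t)) (checkIndex ++ check n ++ κ) (state (length st) u w)
      checkIndices st i j u [] p h = leave refl (switch (failing u [] refl p h))
      checkIndices st i j u (false ∷ w) p h =
        waits 4 (leave refl (switch (put (put
          (checks (var i j ∷ st) (false ∷ u) w (push-≤ {length st} 0 p) h)))))
      checkIndices st i j u (true ∷ w) p h =
        waits 6 (enter refl (put (checkIndices st i (suc j) (true ∷ u) w (drop-≤ 1 p) h)))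

-- What oracle answers say about formulas

encode-nonempty : ∀ {n} (ψ : Formula n) → ¬ [] ≡ encode ψ
encode-nonempty ψ []≡ with () ← trans (cong (decode []) []≡) (decode-encode ψ)

formula-encode : ∀ {n} b bs (ψ : Formula n) → b ∷ bs ≡ encode ψ → formula n (b ∷⁺ bs) ≡ ψ
formula-encode b bs ψ w≡ =
  cong (fromMaybe (const false)) (trans (cong (decode []) w≡) (decode-encode ψ))

VAL-answer : ∀ {m} (ψ : Formula (suc m)) {w y} → w ≡ encode ψ → Answer (VAL (suc m)) w y →
             Ex (suc m) (eval ψ) → FirstMove m (eval ψ) y
VAL-answer ψ {[]}     w≡ y∈ e = ⊥-elim (encode-nonempty ψ w≡)
VAL-answer ψ {b ∷ bs} w≡ y∈ with VAL-sound _ (b ∷⁺ bs) y∈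
... | win rewrite formula-encode b bs ψ w≡ = win

SAT-answer⁻ : ∀ {n} (ψ : Formula n) {w y} → w ≡ encode ψ → Answer (asPromise (SAT n)) w y →
              (y ≡ true → Ex n (eval ψ)) × (y ≡ false → ¬ Ex n (eval ψ))
SAT-answer⁻ ψ {[]}         w≡ y≡ = ⊥-elim (encode-nonempty ψ w≡)
SAT-answer⁻ {n} ψ {b ∷ bs} w≡ refl with SAT-sound n (b ∷⁺ bs) | SAT-complete n (b ∷⁺ bs)
... | sound | complete rewrite formula-encode b bs ψ w≡ =
  sound , λ s≡ e → true≢false (trans (sym (complete e)) s≡)
  where
  true≢false : ¬ true ≡ false
  true≢false ()

≢true : ∀ {b} → ¬ b ≡ true → false ≡ b
≢true {false} b≢ = refl
≢true {true}  b≢ = ⊥-elim (b≢ refl)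

SAT-answer⁺ : ∀ {n} (ψ : Formula n) {w y} → w ≡ encode ψ →
              (y ≡ true → Ex n (eval ψ)) → (y ≡ false → ¬ Ex n (eval ψ)) →
              Answer (asPromise (SAT n)) w y
SAT-answer⁺ ψ {[]}                   w≡ t f = tt
SAT-answer⁺ {n} ψ {b ∷ bs} {y} w≡ t f with SAT-sound n (b ∷⁺ bs) | SAT-complete n (b ∷⁺ bs)
... | sound | complete rewrite formula-encode b bs ψ w≡ with y
...   | true  = sym (complete (t refl))
...   | false = ≢true λ s≡ → f refl (sound s≡)

¬Ex-false : ∀ n → ¬ Ex n (λ _ → false)
¬Ex-false n e = proj₂ (Ex-play n e)

SAT-invalid : ∀ n w → decode {n} [] w ≡ nothing → Answer (asPromise (SAT n)) w false
SAT-invalid n []       w≡ = tt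
SAT-invalid n (b ∷ bs) w≡ with SAT-sound n (b ∷⁺ bs)
... | sound rewrite w≡ = ≢true λ s≡ → ¬Ex-false n (sound s≡)

-- Appended to the code of f, this gives the code of f(x, …) ∧ π₁ x.
∧π₁ : List Bool
∧π₁ = true ∷ true ∷ false ∷ false ∷ false ∷ true ∷ false ∷ []

VAL-reduces : ∀ m w {y} → Answer (asPromise (SAT (suc m))) (w ++ ∧π₁) y →
              Answer (VAL (suc m)) w y
VAL-reduces m []       y∈ = tt
VAL-reduces m (b ∷ bs) {y} y∈ = VAL-complete m (b ∷⁺ bs) win
  where
  win : Ex (suc m) (eval (formula (suc m) (b ∷⁺ bs))) →
        FirstMove m (eval (formula (suc m) (b ∷⁺ bs))) y
  win e with decode {suc m} [] (b ∷ bs) in eq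
  -- The string stands for the constant 0, so any bit is allowed, whatever the extended string may
  -- mean.
  ... | nothing = ⊥-elim (¬Ex-false (suc m) e)
  ... | just ψ with SAT-answer⁻ (and ψ (var zero 0)) (cong (_++ ∧π₁) (decode-sound [] (b ∷ bs) eq)) y∈
  ...   | t , f = and-var₀ ψ t f e

-- Bounds on lengths and times

encode-mapVars-≤ : ∀ {m n} (σ : Fin m → ℕ → Formula n) →
  (∀ i j → length (encode (σ i j)) ≤ length (encode (var i j))) →
  ∀ ψ → length (encode (mapVars σ ψ)) ≤ length (encode ψ)
encode-mapVars-≤ σ σ≤ (const b) = ≤-refl
encode-mapVars-≤ σ σ≤ (var i j) = σ≤ i j
encode-mapVars-≤ σ σ≤ (neg ψ)
  rewrite length-++ (encode ψ) {true ∷ false ∷ []}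
        | length-++ (encode (mapVars σ ψ)) {true ∷ false ∷ []} =
  +-monoˡ-≤ 2 (encode-mapVars-≤ σ σ≤ ψ)
encode-mapVars-≤ σ σ≤ (and ψ χ)
  rewrite length-++ (encode ψ) {encode χ ++ false ∷ true ∷ false ∷ []}
        | length-++ (encode (mapVars σ ψ)) {encode (mapVars σ χ) ++ false ∷ true ∷ false ∷ []}
        | length-++ (encode χ) {false ∷ true ∷ false ∷ []}
        | length-++ (encode (mapVars σ χ)) {false ∷ true ∷ false ∷ []} =
  +-mono-≤ (encode-mapVars-≤ σ σ≤ ψ) (+-monoˡ-≤ 3 (encode-mapVars-≤ σ σ≤ χ))
encode-mapVars-≤ σ σ≤ (or ψ χ)
  rewrite length-++ (encode ψ) {encode χ ++ false ∷ true ∷ true ∷ []}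
        | length-++ (encode (mapVars σ ψ)) {encode (mapVars σ χ) ++ false ∷ true ∷ true ∷ []}
        | length-++ (encode χ) {false ∷ true ∷ true ∷ []}
        | length-++ (encode (mapVars σ χ)) {false ∷ true ∷ true ∷ []} =
  +-mono-≤ (encode-mapVars-≤ σ σ≤ ψ) (+-monoˡ-≤ 3 (encode-mapVars-≤ σ σ≤ χ))

module _ {m : ℕ} where

  fixVar-≤ : ∀ Cs j → length (encode (fixVar {m} Cs j)) ≤ length (encode (var {suc m} zero j))
  fixVar-≤ []       j       = ≤-refl
  fixVar-≤ (_ ∷ Cs) zero    = s≤s (s≤s (s≤s z≤n))
  fixVar-≤ (_ ∷ Cs) (suc j) = ≤-trans (fixVar-≤ Cs j) (n≤1+n _)

  restrict-≤ : ∀ Cs (ψ : Formula (suc m)) → length (encode (restrict Cs ψ)) ≤ length (encode ψ)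
  restrict-≤ Cs = encode-mapVars-≤ (fixed-σ Cs) λ { zero j → fixVar-≤ Cs j ; (suc i) j → ≤-refl }

  demote-≤ : ∀ Cs (ψ : Formula (suc m)) → length (encode (demote Cs ψ)) ≤ length (encode ψ)
  demote-≤ Cs = encode-mapVars-≤ (demoted-σ Cs) λ
    { zero j → fixVar-≤ Cs j ; (suc zero) j → ≤-refl ; (suc (suc i)) j → shorter i j }
    where
    shorter : ∀ {m} (i : Fin m) j →
      length (encode (var (inject₁ (suc i)) j)) ≤ length (encode (var (suc (suc i)) j))
    shorter i j rewrite toℕ-inject₁ i = s≤s (s≤s (n≤1+n _))

spend : ∀ {g k φ} {P : Vec (HalfTapes g) (suc k) → Set} {B t κ ts} c w →
  length w ≤ B → Ev φ P (fuel c w t) κ ts → Ev φ P (B * c + t) κ ts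
spend {B = B} {t} c w w≤B = weaken
  (≤-trans (≤-reflexive (fuel-length c w t)) (+-monoˡ-≤ t (*-monoˡ-≤ c w≤B)))

length-rev : ∀ (w : List Bool) {B} → length w ≤ B → length (w ʳ++ []) ≤ B
length-rev w = subst (_≤ _) (sym (trans (length-ʳ++ w) (+-identityʳ _)))

rev-rev : ∀ (w : List Bool) → (w ʳ++ []) ʳ++ [] ≡ w
rev-rev w = trans (ʳ++-ʳ++ w) (++-identityʳ w)

-- Answering `VAL` by one query to `SAT`

consult copyAll : Code 6
consult = rewind O ++ ask D ∷ clear O
copyAll = loop (isBit Q) copyBit ∷ []

valCode : Code 6
valCode = fetch ++ copyAll ++ emit ∧π₁ ++ consult ++ rewind Q ++ clear Q

consultTime : ℕ → ℕ → ℕ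
consultTime B t = B * 2 + (5 + (B * 2 + (1 + t)))

module _ {g : ℕ} {φ : PromiseProblem} {P : Vec (HalfTapes g) 6 → Set} where

  rewinds-Q : ∀ {B t κ o s d n c} w → length w ≤ B →
    Ev φ P t κ (o ∷ s ∷ d ∷ ⟨ [] ∣ w ⟩ ∷ n ∷ c ∷ []) →
    Ev φ P (B * 2 + (3 + t)) (rewind Q ++ κ) (o ∷ s ∷ d ∷ ⟨ w ʳ++ [] ∣ [] ⟩ ∷ n ∷ c ∷ [])
  rewinds-Q {B} {t} {κ} {o} {s} {d} {n} {c} w w≤B e = spend 2 (w ʳ++ []) (length-rev w w≤B)
    (rewinds (o ∷ s ∷ d ∷ empty ∷ n ∷ c ∷ []) Q (w ʳ++ []) []
      (subst (λ w → Ev φ P t κ (o ∷ s ∷ d ∷ ⟨ [] ∣ w ⟩ ∷ n ∷ c ∷ [])) (sym (rev-rev w)) e))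

  consults : ∀ {B t κ s q n c} w → length w ≤ B →
    (∀ y → Answer φ w y →
       Ev φ P t κ (empty ∷ s ∷ ⟨ [] ∣ y ∷ [] ⟩ ∷ q ∷ n ∷ c ∷ [])) →
    Ev φ P (consultTime B t) (consult ++ κ)
       (⟨ w ʳ++ [] ∣ [] ⟩ ∷ s ∷ empty ∷ q ∷ n ∷ c ∷ [])
  consults {B} {t} {κ} {s} {q} {n} {c} w w≤B e = spend 2 (w ʳ++ []) (length-rev w w≤B)
    (rewinds (empty ∷ s ∷ empty ∷ q ∷ n ∷ c ∷ []) O (w ʳ++ []) []
      (subst (λ w → Ev φ P (2 + (B * 2 + suc t)) (ask D ∷ clear O ++ κ)
                       (⟨ [] ∣ w ⟩ ∷ s ∷ empty ∷ q ∷ n ∷ c ∷ []))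
        (sym (rev-rev w))
        (ask λ y y∈ → spend 2 w w≤B
          (clears (empty ∷ s ∷ ⟨ [] ∣ y ∷ [] ⟩ ∷ q ∷ n ∷ c ∷ []) O w
            (e y (subst (λ w → Answer φ w y) (leadingBits-bits w) y∈))))))

  copiesAll : ∀ {t κ s d n c} w u o →
    Ev φ P t κ (⟨ w ʳ++ o ∣ [] ⟩ ∷ s ∷ d ∷ ⟨ w ʳ++ u ∣ [] ⟩ ∷ n ∷ c ∷ []) →
    Ev φ P (fuel 3 w (suc t)) (copyAll ++ κ)
       (⟨ o ∣ [] ⟩ ∷ s ∷ d ∷ ⟨ u ∣ w ⟩ ∷ n ∷ c ∷ [])
  copiesAll []      u o e = leave refl e
  copiesAll (b ∷ w) u o e = enter refl (put (put (copiesAll w (b ∷ u) (b ∷ o) e)))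

valTime : ℕ → ℕ
valTime B = B * 6 + (4 + (B * 3 + (1 + (7 + consultTime B (B * 2 + (3 + (B * 2 + (1 + 0))))))))

Answered : ∀ {g} → PromiseProblem → List (Sym g) → List (Sym g) → Vec (HalfTapes g) 6 → Set
Answered φ ls rs ts = ∃ λ y → Answer φ (leadingBits rs) y ×
  ts ≡ empty ∷ (ls , rs) ∷ ⟨ [] ∣ y ∷ [] ⟩ ∷ empty ∷ empty ∷ empty ∷ []

valCode-correct : ∀ {g} m (ls rs : List (Sym g)) →
  Ev (asPromise (SAT (suc m))) (Answered (VAL (suc m)) ls rs)
     (valTime (7 + length (leadingBits rs))) valCode
     (empty ∷ (ls , rs) ∷ empty ∷ empty ∷ empty ∷ empty ∷ [])
valCode-correct {g} m ls rs = spend 6 w w≤ (fetches ls rs (spend 3 w w≤ (copiesAll w [] []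
  (emits ∧π₁ (w ʳ++ []) (subst
    (λ v → Ev (asPromise (SAT (suc m))) (Answered (VAL (suc m)) ls rs)
             (consultTime B (B * 2 + (3 + (B * 2 + (1 + 0)))))
             (consult ++ rewind Q ++ clear Q)
             (⟨ v ∣ [] ⟩ ∷ (ls , rs) ∷ empty ∷ ⟨ w ʳ++ [] ∣ [] ⟩ ∷ empty ∷ empty ∷ []))
    (++-ʳ++ w {∧π₁})
    (consults (w ++ ∧π₁) (≤-reflexive (trans (length-++ w) (+-comm (length w) 7))) λ y y∈ →
      rewinds-Q w w≤ (spend 2 w w≤
        (clears (empty ∷ (ls , rs) ∷ ⟨ [] ∣ y ∷ [] ⟩ ∷ empty ∷ empty ∷ empty ∷ []) Q w
          (done (y , VAL-reduces m w y∈ , refl))))))))))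
  where
  w : List Bool
  w = leadingBits rs
  B : ℕ
  B = 7 + length w
  w≤ : length w ≤ B
  w≤ = m≤n+m (length w) 7

poly-step : ∀ {f} c k → IsPoly f → IsPoly (λ n → n * c + (k + f n))
poly-step c k pf = poly-+ (poly-* poly-id (poly-const c)) (poly-+ (poly-const k) pf)

consultTime-poly : ∀ {f} → IsPoly f → IsPoly (λ n → consultTime n (f n))
consultTime-poly pf = poly-step 2 5 (poly-step 2 1 pf)

VAL⇐SAT : ∀ m → Subroutine (VAL (suc m)) (asPromise (SAT (suc m)))
VAL⇐SAT m = record
  { code = valCode
  ; time = λ n → valTime (7 + n)
  ; time-poly = poly-∘ {valTime} {7 +_}
      (poly-step 6 4 (poly-step 3 1 (poly-+ (poly-const 7)
        (consultTime-poly (poly-step 2 3 (poly-step 2 1 (poly-const 0)))))))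
      (poly-+ (poly-const 7) poly-id)
  ; correct = valCode-correct m
  }

-- Answering `SAT` by queries to `VAL`

extend round fill finish search reject decide : Code 6
extend = rewind Q ++ forward C ++ put C (copy D) right ∷ put D (fixed nothing) stay ∷ rewind C
round  = transduce copyVar ++ consult ++ extend
fill   = loop (isBit Q) (put N (copy Q) right ∷ put Q keep right ∷ []) ∷ []
finish =
  -- This writes the code of `verdict`: the three strings are the tokens `var zero 0`; then `and`,
  -- `var zero 0`; finally `neg`, `and`, `or`, where the second string also ends with the `neg` of
  -- its variable.
  emit (true ∷ true ∷ false ∷ false ∷ []) ++ transduce copyVar ++ rewind Q ++
  emit (false ∷ true ∷ false ∷ true ∷ true ∷ false ∷ false ∷ true ∷ false ∷ []) ++
  transduce demoteVar ++ rewind Q ++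
  emit (true ∷ false ∷ false ∷ true ∷ false ∷ false ∷ true ∷ true ∷ []) ++ consult
-- The copy of the code on N is a counter, of which each round erases one bit.
search = fill ++ rewind Q ++ put N keep left ∷
  loop (isBit N) (round ++ put N (fixed nothing) left ∷ []) ∷ finish ++ clear C
reject = put D (fixed (just false)) stay ∷ []
decide = put D keep left ∷ switch D (λ
  -- Heights 0, 1 and at least 2 are told apart here. In each case D is blank again before it
  -- receives the answer.
  { nothing  → reject
  ; (just _) → put D (fixed nothing) left ∷ switch D (λ
    { nothing  → search
    ; (just _) → loop (isBit D) (put D (fixed nothing) left ∷ []) ∷ reject }) ∷ [] }) ∷ []

satCode : ℕ → Code 6
satCode n = fetch ++ check n ++ rewind Q ++ decide ++ clear Q

extendTime roundTime finishTime searchTime decideTime : ℕ → ℕ → ℕ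
extendTime B t = B * 2 + (3 + (B * 2 + (3 + (B * 2 + (3 + t)))))
roundTime  B t = B * 8 + (1 + consultTime B (extendTime B t))
finishTime B t = 4 + (B * 8 + (1 + (B * 2 + (12 + (B * 8 + (1 + (B * 2 + (11 + consultTime B t))))))))
searchTime B t = B * 3 + (1 + (B * 2 + (4 + (B * (2 + roundTime B 0) + (1 + finishTime B (B * 2 + (1 + t)))))))
decideTime B t = 4 + (B * 2 + (4 + searchTime B t))

satTime : ℕ → ℕ
satTime B = B * 6 + (4 + (B * 8 + (6 + (B * 2 + (3 + decideTime B (B * 2 + (1 + 0)))))))

-- The time bounds contain the budget of the code that follows. Once it splits off as a summand,
-- every round has the same cost, and the loop costs a multiple of it.
Additive : (ℕ → ℕ) → Set
Additive f = ∀ t → f t ≡ f 0 + t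

additive-+ : ∀ n {f} → Additive f → Additive (λ t → n + f t)
additive-+ n {f} f+ t = trans (cong (n +_) (f+ t)) (sym (+-assoc n (f 0) t))

additive-∘ : ∀ {f h} → Additive f → Additive h → Additive (λ t → f (h t))
additive-∘ {f} {h} f+ h+ t = trans (f+ (h t)) (trans (cong (f 0 +_) (h+ t))
  (trans (sym (+-assoc (f 0) (h 0) t)) (cong (_+ t) (sym (f+ (h 0))))))

additive-id : Additive (λ t → t)
additive-id t = refl

additive-step : ∀ n k {f} → Additive f → Additive (λ t → n + (k + f t))
additive-step n k f+ = additive-+ n (additive-+ k f+)

consultTime-additive : ∀ B → Additive (consultTime B)
consultTime-additive B = additive-step (B * 2) 5 (additive-step (B * 2) 1 additive-id)

roundTime-additive : ∀ B → Additive (roundTime B)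
roundTime-additive B = additive-step (B * 8) 1
  (additive-∘ (consultTime-additive B)
    (additive-step (B * 2) 3 (additive-step (B * 2) 3 (additive-step (B * 2) 3 additive-id))))

searchTime-additive : ∀ B → Additive (searchTime B)
searchTime-additive B = additive-step (B * 3) 1 (additive-step (B * 2) 4
  (additive-step (B * (2 + roundTime B 0)) 1
    (additive-∘ {finishTime B} (additive-+ 4 (additive-step (B * 8) 1 (additive-step (B * 2) 12
        (additive-step (B * 8) 1 (additive-step (B * 2) 11 (consultTime-additive B))))))
      (additive-step (B * 2) 1 additive-id))))

encode-verdict : ∀ {m} Cs (ψ : Formula (suc m)) → encode (verdict Cs ψ) ≡
  true ∷ true ∷ false ∷ false ∷ encode (restrict Cs ψ) ++
  false ∷ true ∷ false ∷ true ∷ true ∷ false ∷ false ∷ true ∷ false ∷ encode (demote Cs ψ) ++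
  true ∷ false ∷ false ∷ true ∷ false ∷ false ∷ true ∷ true ∷ []
encode-verdict Cs ψ = cong (λ w → true ∷ true ∷ false ∷ false ∷ w)
  (trans (++-assoc (encode (restrict Cs ψ)) _ _)
    (cong (λ w → encode (restrict Cs ψ) ++
                 false ∷ true ∷ false ∷ true ∷ true ∷ false ∷ false ∷ true ∷ false ∷ w)
      (trans (++-assoc (encode (demote Cs ψ) ++ true ∷ false ∷ []) _ _)
             (++-assoc (encode (demote Cs ψ)) _ _))))

-- The 21 is 4 + 9 + 8, the bits that `finish` emits around the two substituted copies, neither of
-- which is longer than the original.
verdict-≤ : ∀ {m} Cs (ψ : Formula (suc m)) →
  length (encode (verdict Cs ψ)) ≤ 21 + (length (encode ψ) + length (encode ψ))
verdict-≤ Cs ψ =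
  ≤-trans (≤-reflexive (trans (cong length (encode-verdict Cs ψ))
    (cong (4 +_) (trans (length-++ (encode (restrict Cs ψ)))
      (cong (λ l → length (encode (restrict Cs ψ)) + (9 + l)) (length-++ (encode (demote Cs ψ))))))))
  (≤-trans (+-monoʳ-≤ 4 (+-mono-≤ (restrict-≤ Cs ψ) (+-monoʳ-≤ 9 (+-monoˡ-≤ 8 (demote-≤ Cs ψ)))))
    (≤-reflexive (solve 1 (λ l → con 4 :+ (l :+ (con 9 :+ (l :+ con 8))) := con 21 :+ (l :+ l)) refl
      (length (encode ψ)))))

encode-≤ : ∀ {n} (ψ : Formula n) {B} → 21 + (length (encode ψ) + length (encode ψ)) ≤ B →
           length (encode ψ) ≤ B
encode-≤ ψ = ≤-trans (≤-trans (m≤m+n (length (encode ψ)) (length (encode ψ))) (m≤n+m _ 21))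

module _ {g : ℕ} {φ : PromiseProblem} {P : Vec (HalfTapes g) 6 → Set} where

  extends : ∀ {B t κ s n} w Cs y → length w ≤ B → suc (length Cs) ≤ B →
    Ev φ P t κ (empty ∷ s ∷ empty ∷ ⟨ [] ∣ w ⟩ ∷ n ∷ ⟨ [] ∣ Cs ++ y ∷ [] ⟩ ∷ []) →
    Ev φ P (extendTime B t) (extend ++ κ)
       (empty ∷ s ∷ ⟨ [] ∣ y ∷ [] ⟩ ∷ ⟨ w ʳ++ [] ∣ [] ⟩ ∷ n ∷ ⟨ [] ∣ Cs ⟩ ∷ [])
  extends {B} {t} {κ} {s} {n} w Cs y w≤ Cs≤ e = rewinds-Q w w≤
    (spend 2 Cs (<⇒≤ Cs≤)
      (forwards (empty ∷ s ∷ ⟨ [] ∣ y ∷ [] ⟩ ∷ ⟨ [] ∣ w ⟩ ∷ n ∷ empty ∷ []) C [] Cs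
        (put (put (spend 2 (y ∷ Cs ʳ++ []) y≤
          (rewinds (empty ∷ s ∷ empty ∷ ⟨ [] ∣ w ⟩ ∷ n ∷ empty ∷ []) C (y ∷ Cs ʳ++ []) []
            (subst (λ Cs → Ev φ P t κ (empty ∷ s ∷ empty ∷ ⟨ [] ∣ w ⟩ ∷ n ∷ ⟨ [] ∣ Cs ⟩ ∷ []))
                   (sym (ʳ++-ʳ++ Cs)) e)))))))
    where
    y≤ : suc (length (Cs ʳ++ [])) ≤ B
    y≤ = subst (λ l → suc l ≤ B) (sym (trans (length-ʳ++ Cs) (+-identityʳ _))) Cs≤

  fills : ∀ {t κ o s d c} w u v →
    Ev φ P t κ (o ∷ s ∷ d ∷ ⟨ w ʳ++ u ∣ [] ⟩ ∷ ⟨ w ʳ++ v ∣ [] ⟩ ∷ c ∷ []) →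
    Ev φ P (fuel 3 w (suc t)) (fill ++ κ)
       (o ∷ s ∷ d ∷ ⟨ u ∣ w ⟩ ∷ ⟨ v ∣ [] ⟩ ∷ c ∷ [])
  fills []      u v e = leave refl e
  fills (b ∷ w) u v e = enter refl (put (put (fills w (b ∷ u) (b ∷ v) e)))

  clears-D : ∀ {t κ o s q n c} d →
    Ev φ P t κ (o ∷ s ∷ empty ∷ q ∷ n ∷ c ∷ []) →
    Ev φ P (fuel 2 (replicate d true) (3 + t))
       (loop (isBit D) (put D (fixed nothing) left ∷ []) ∷ κ)
       (o ∷ s ∷ ⟨ replicate d true ∣ true ∷ [] ⟩ ∷ q ∷ n ∷ c ∷ [])
  clears-D zero    e = enter refl (put (leave refl e))
  clears-D (suc d) e = enter refl (put (clears-D d e))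

  module _ {m : ℕ} (ψ : Formula (suc m)) {B : ℕ}
           (B≥ : 21 + (length (encode ψ) + length (encode ψ)) ≤ B) where

    transduces-copied : ∀ {t κ s d n} Cs o →
      Ev φ P t κ (⟨ encode (restrict Cs ψ) ʳ++ o ∣ [] ⟩ ∷ s ∷ d ∷
                  ⟨ encode ψ ʳ++ [] ∣ [] ⟩ ∷ n ∷ ⟨ [] ∣ Cs ⟩ ∷ []) →
      Ev φ P (B * 8 + (1 + t)) (transduce copyVar ++ κ)
         (⟨ o ∣ [] ⟩ ∷ s ∷ d ∷ ⟨ [] ∣ encode ψ ⟩ ∷ n ∷ ⟨ [] ∣ Cs ⟩ ∷ [])
    transduces-copied Cs o e = spend 8 (encode ψ) (encode-≤ ψ B≥)
      (transduces (fixed-σ Cs) (λ _ → refl) rewrites-copied ψ o e)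

    transduces-demoted : ∀ {t κ s d n} Cs o →
      Ev φ P t κ (⟨ encode (demote Cs ψ) ʳ++ o ∣ [] ⟩ ∷ s ∷ d ∷
                  ⟨ encode ψ ʳ++ [] ∣ [] ⟩ ∷ n ∷ ⟨ [] ∣ Cs ⟩ ∷ []) →
      Ev φ P (B * 8 + (1 + t)) (transduce demoteVar ++ κ)
         (⟨ o ∣ [] ⟩ ∷ s ∷ d ∷ ⟨ [] ∣ encode ψ ⟩ ∷ n ∷ ⟨ [] ∣ Cs ⟩ ∷ [])
    transduces-demoted Cs o e = spend 8 (encode ψ) (encode-≤ ψ B≥)
      (transduces (demoted-σ Cs) (λ _ → refl) rewrites-demoted ψ o e)

    rounds-once : ∀ {t κ s n} Cs → suc (length Cs) ≤ B →
      (∀ y → Answer φ (encode (restrict Cs ψ)) y →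
         Ev φ P t κ (empty ∷ s ∷ empty ∷ ⟨ [] ∣ encode ψ ⟩ ∷ n ∷ ⟨ [] ∣ Cs ++ y ∷ [] ⟩ ∷ [])) →
      Ev φ P (roundTime B t) (round ++ κ)
         (empty ∷ s ∷ empty ∷ ⟨ [] ∣ encode ψ ⟩ ∷ n ∷ ⟨ [] ∣ Cs ⟩ ∷ [])
    rounds-once Cs Cs≤ e = transduces-copied Cs []
      (consults (encode (restrict Cs ψ)) (≤-trans (restrict-≤ Cs ψ) (encode-≤ ψ B≥)) λ y y∈ →
        extends (encode ψ) Cs y (encode-≤ ψ B≥) Cs≤ (e y y∈))

    finishes : ∀ {t κ s n} Cs →
      (∀ y → Answer φ (encode (verdict Cs ψ)) y →
         Ev φ P t κ (empty ∷ s ∷ ⟨ [] ∣ y ∷ [] ⟩ ∷ ⟨ [] ∣ encode ψ ⟩ ∷ n ∷ ⟨ [] ∣ Cs ⟩ ∷ [])) →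
      Ev φ P (finishTime B t) (finish ++ κ)
         (empty ∷ s ∷ empty ∷ ⟨ [] ∣ encode ψ ⟩ ∷ n ∷ ⟨ [] ∣ Cs ⟩ ∷ [])
    finishes {t} {κ} {s} {n} Cs e =
      emits (true ∷ true ∷ false ∷ false ∷ []) []
        (transduces-copied Cs _ (rewinds-Q (encode ψ) (encode-≤ ψ B≥)
          (emits (false ∷ true ∷ false ∷ true ∷ true ∷ false ∷ false ∷ true ∷ false ∷ []) _
            (transduces-demoted Cs _ (rewinds-Q (encode ψ) (encode-≤ ψ B≥)
              (emits (true ∷ false ∷ false ∷ true ∷ false ∷ false ∷ true ∷ true ∷ []) _
                (subst (λ w → Ev φ P (consultTime B t) (consult ++ κ)
                                 (⟨ w ∣ [] ⟩ ∷ s ∷ empty ∷ ⟨ [] ∣ encode ψ ⟩ ∷ n ∷ ⟨ [] ∣ Cs ⟩ ∷ []))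
                  written≡
                  (consults (encode (verdict Cs ψ)) (≤-trans (verdict-≤ Cs ψ) B≥) e))))))))
      where
      written≡ : encode (verdict Cs ψ) ʳ++ [] ≡
        (true ∷ false ∷ false ∷ true ∷ false ∷ false ∷ true ∷ true ∷ []) ʳ++
        encode (demote Cs ψ) ʳ++
        (false ∷ true ∷ false ∷ true ∷ true ∷ false ∷ false ∷ true ∷ false ∷ []) ʳ++
        encode (restrict Cs ψ) ʳ++ (true ∷ true ∷ false ∷ false ∷ []) ʳ++ []
      written≡ = trans (cong (_ʳ++ []) (encode-verdict Cs ψ))
        (trans (++-ʳ++ (encode (restrict Cs ψ))) (++-ʳ++ (encode (demote Cs ψ))))

module _ {g : ℕ} {m : ℕ} {P : Vec (HalfTapes g) 6 → Set} (ψ : Formula (suc m)) {B : ℕ}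
         (B≥ : 21 + (length (encode ψ) + length (encode ψ)) ≤ B) where

  -- Only an implication, as the oracle returns arbitrary bits when the formula is unsatisfiable.
  Consistent : List Bool → Set
  Consistent Cs = Ex (suc m) (eval ψ) → Ex (suc m) (eval (restrict Cs ψ))

  rounds : ∀ {t κ s} n Cs → length n + length Cs ≡ length (encode ψ) → Consistent Cs →
    (∀ Cs → length Cs ≡ length (encode ψ) → Consistent Cs →
       Ev (VAL (suc m)) P t κ
          (empty ∷ s ∷ empty ∷ ⟨ [] ∣ encode ψ ⟩ ∷ empty ∷ ⟨ [] ∣ Cs ⟩ ∷ [])) →
    Ev (VAL (suc m)) P (length n * (2 + roundTime B 0) + (1 + t))
       (loop (isBit N) (round ++ put N (fixed nothing) left ∷ []) ∷ κ)
       (empty ∷ s ∷ empty ∷ ⟨ [] ∣ encode ψ ⟩ ∷ go left ⟨ n ∣ [] ⟩ ∷ ⟨ [] ∣ Cs ⟩ ∷ [])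
  rounds []      Cs len cons e = leave refl (e Cs len cons)
  rounds {t} (b ∷ n) Cs len cons e = enter refl (weaken (≤-reflexive time≡)
    (rounds-once ψ B≥ Cs Cs≤ λ y y∈ → put
      (rounds n (Cs ++ y ∷ []) len′
        (λ ex → restrict-∷ʳ Cs ψ (VAL-answer (restrict Cs ψ) refl y∈ (cons ex))) e)))
    where
    Cs≤ : suc (length Cs) ≤ B
    Cs≤ = ≤-trans (s≤s (m≤n+m (length Cs) (length n)))
      (≤-trans (≤-reflexive len) (encode-≤ ψ B≥))

    len′ : ∀ {y} → length n + length (Cs ++ y ∷ []) ≡ length (encode ψ)
    len′ {y} = trans (cong (length n +_) (trans (length-++ Cs) (+-comm (length Cs) 1)))
      (trans (+-suc (length n) (length Cs)) len)

    R = roundTime B 0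
    rest-time = length n * (2 + R) + (1 + t)

    time≡ : roundTime B (suc rest-time) ≡ suc (R + length n * (2 + R) + (1 + t))
    time≡ = trans (roundTime-additive B (suc rest-time))
      (trans (+-suc R rest-time) (cong suc (sym (+-assoc R (length n * (2 + R)) (1 + t)))))

  searches : ∀ {t κ s} →
    (∀ y → Answer (asPromise (SAT (suc m))) (encode ψ) y →
       Ev (VAL (suc m)) P t κ
          (empty ∷ s ∷ ⟨ [] ∣ y ∷ [] ⟩ ∷ ⟨ [] ∣ encode ψ ⟩ ∷ empty ∷ empty ∷ [])) →
    Ev (VAL (suc m)) P (searchTime B t) (search ++ κ)
       (empty ∷ s ∷ empty ∷ ⟨ [] ∣ encode ψ ⟩ ∷ empty ∷ empty ∷ [])
  searches {t} {κ} {s} e = spend 3 (encode ψ) w≤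
    (fills (encode ψ) [] [] (rewinds-Q (encode ψ) w≤ (put (weaken time≤
      (rounds (encode ψ ʳ++ []) [] (trans (+-identityʳ _) rev-length) (restrict-[] ψ) λ Cs len cons →
        finishes ψ B≥ Cs λ y y∈ → spend 2 Cs (≤-trans (≤-reflexive len) w≤)
          (clears (empty ∷ s ∷ ⟨ [] ∣ y ∷ [] ⟩ ∷ ⟨ [] ∣ encode ψ ⟩ ∷ empty ∷ empty ∷ []) C Cs
            (e y (answer Cs len cons y∈))))))))
    where
    w≤ : length (encode ψ) ≤ B
    w≤ = encode-≤ ψ B≥

    rev-length : length (encode ψ ʳ++ []) ≡ length (encode ψ)
    rev-length = trans (length-ʳ++ (encode ψ)) (+-identityʳ _)

    time≤ : ∀ {t} → length (encode ψ ʳ++ []) * (2 + roundTime B 0) + t ≤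
                    B * (2 + roundTime B 0) + t
    time≤ {t} = +-monoˡ-≤ t (*-monoˡ-≤ (2 + roundTime B 0) (≤-trans (≤-reflexive rev-length) w≤))

    answer : ∀ Cs → length Cs ≡ length (encode ψ) → Consistent Cs →
             ∀ {y} → Answer (VAL (suc m)) (encode (verdict Cs ψ)) y →
             Answer (asPromise (SAT (suc m))) (encode ψ) y
    -- A 1 certifies satisfiability by itself; a 0 refutes only the restricted formula, and `cons`
    -- transfers this to `ψ`.
    answer Cs len cons y∈ = SAT-answer⁺ ψ refl (proj₁ decided) (λ y≡ → proj₂ decided y≡ ∘ cons)
      where
      long : maxIndex ψ zero < length Cs
      long = subst (maxIndex ψ zero <_) (sym len) (maxIndex-< ψ zero)
      decided = verdict-decides Cs ψ long
        (VAL-answer (verdict Cs ψ) refl y∈ (verdict-wins Cs ψ long))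

≤-additive : ∀ {f t} → Additive f → t ≤ f t
≤-additive {f} {t} f+ = ≤-trans (m≤n+m t (f 0)) (≤-reflexive (sym (f+ t)))

module _ {g : ℕ} {m : ℕ} {P : Vec (HalfTapes g) 6 → Set} where

  decides : ∀ {t κ s d B} w → Verdict (decode {suc m} [] w) d → d ≤ 2 + length w →
    21 + (length w + length w) ≤ B →
    (∀ y → Answer (asPromise (SAT (suc m))) w y →
       Ev (VAL (suc m)) P t κ
          (empty ∷ s ∷ ⟨ [] ∣ y ∷ [] ⟩ ∷ ⟨ [] ∣ w ⟩ ∷ empty ∷ empty ∷ [])) →
    Ev (VAL (suc m)) P (decideTime B t) (decide ++ κ)
       (empty ∷ s ∷ ⟨ replicate d true ∣ [] ⟩ ∷ ⟨ [] ∣ w ⟩ ∷ empty ∷ empty ∷ [])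
  decides {t} {κ} {s} {d} {B} w v d≤ B≥ e with decode {suc m} [] w in eq
  decides {t} {κ} {s} {B = B} w valid d≤ B≥ e | just ψ
    with refl ← decode-sound [] w eq =
    put (switch (put (switch (weaken
      (≤-trans (m≤n+m _ 4) (m≤n+m _ (B * 2)))
      (searches ψ B≥ e)))))
  decides {t} {B = B} w underflow d≤ B≥ e | nothing =
    put (switch (weaken time≤ (put (e false (SAT-invalid (suc m) w eq)))))
    where
    time≤ : suc t ≤ 2 + (B * 2 + (4 + searchTime B t))
    time≤ = s≤s (≤-trans (≤-additive (searchTime-additive B))
      (≤-trans (m≤n+m _ 4) (≤-trans (m≤n+m _ (B * 2)) (n≤1+n _))))
  decides {t} {B = B} w (failed {d}) d≤ B≥ e | nothing =
    put (switch (put (switch (weaken time≤ (spend 2 (replicate d true) d≤B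
      (clears-D d (put (e false (SAT-invalid (suc m) w eq)))))))))
    where
    d≤B : length (replicate d true) ≤ B
    d≤B = ≤-trans (≤-reflexive (length-replicate d))
      (≤-trans (s≤s⁻¹ (s≤s⁻¹ d≤)) (≤-trans (m≤m+n (length w) (length w)) (≤-trans (m≤n+m _ 21) B≥)))
    time≤ : B * 2 + (3 + suc t) ≤ B * 2 + (4 + searchTime B t)
    time≤ = +-monoʳ-≤ (B * 2) (+-monoʳ-≤ 4 (≤-additive (searchTime-additive B)))

satCode-correct : ∀ {g} m (ls rs : List (Sym g)) →
  Ev (VAL (suc m)) (Answered (asPromise (SAT (suc m))) ls rs)
     (satTime (21 + (length (leadingBits rs) + length (leadingBits rs)))) (satCode (suc m))
     (empty ∷ (ls , rs) ∷ empty ∷ empty ∷ empty ∷ empty ∷ [])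
satCode-correct {g} m ls rs = spend 6 w w≤ (fetches ls rs (spend 8 w w≤
  (checks {N = length w} [] [] w ≤-refl λ v d≤ →
    rewinds-Q w w≤ (decides w v d≤ ≤-refl λ y y∈ → spend 2 w w≤
      (clears (empty ∷ (ls , rs) ∷ ⟨ [] ∣ y ∷ [] ⟩ ∷ empty ∷ empty ∷ empty ∷ []) Q w
        (done (y , y∈ , refl)))))))
  where
  w : List Bool
  w = leadingBits rs
  w≤ : length w ≤ 21 + (length w + length w)
  w≤ = ≤-trans (m≤m+n (length w) (length w)) (m≤n+m _ 21)

SAT⇐VAL : ∀ m → Subroutine (asPromise (SAT (suc m))) (VAL (suc m))
SAT⇐VAL m = record
  { code = satCode (suc m)
  ; time = λ n → satTime (21 + (n + n))
  ; time-poly = poly-∘ {satTime} {λ n → 21 + (n + n)}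
      (poly-step 6 4 (poly-step 8 6 (poly-step 2 3 (decideTime-poly (poly-step 2 1 (poly-const 0))))))
      (poly-+ (poly-const 21) (poly-+ poly-id poly-id))
  ; correct = satCode-correct m
  }
  where
  roundTime-poly : IsPoly (λ n → roundTime n 0)
  roundTime-poly = poly-step 8 1 (consultTime-poly
    (poly-step 2 3 (poly-step 2 3 (poly-step 2 3 (poly-const 0)))))

  finishTime-poly : ∀ {f} → IsPoly f → IsPoly (λ n → finishTime n (f n))
  finishTime-poly pf = poly-+ (poly-const 4) (poly-step 8 1 (poly-step 2 12
    (poly-step 8 1 (poly-step 2 11 (consultTime-poly pf)))))

  decideTime-poly : ∀ {f} → IsPoly f → IsPoly (λ n → decideTime n (f n))
  decideTime-poly pf = poly-+ (poly-const 4) (poly-step 2 4 (poly-step 3 1 (poly-step 2 4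
    (poly-+ (poly-* poly-id (poly-+ (poly-const 2) roundTime-poly))
      (poly-+ (poly-const 1) (finishTime-poly (poly-step 2 1 pf)))))))

theorem11 : (n : ℕ) .{{_ : NonZero n}} → P̂ (VAL n) ≐ P̂ (asPromise (SAT n))
theorem11 (suc m) = P̂-⊆ (VAL⇐SAT m) , P̂-⊆ (SAT⇐VAL m)
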